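{- For $n\in\mathbb{N}$, the number of lattice points in the interior or on the boundary of a circle of radius $\sqrt{2n}$ centered at the origin is $4\mathcal{R}_n+4n+1$. That is, $$\#\{(a,b)\in\mathbb{Z}^2 : a^2+b^2\le 2n\}=4\mathcal{R}_n+4n+1.$$
   Context: $\mathbb{N}$ denotes the set of positive integers. The nearest integer function $\mathrm{nint}$ rounds a real number to the nearest integer, with half-integers rounded up: $\mathrm{nint}(x)=\max\{z\in\mathbb{Z} : |z-x|\le |z'-x|\text{ for all } z'\in\mathbb{Z}\}=\lfloor x+1/2\rfloor$. For $n\in\mathbb{N}$, $\mathcal{R}_n = \#\{k\in\mathbb{Z} : 1\le k\le n,\ \mathrm{nint}(n/k)\text{ is odd}\}$. -}

module Defs where

open import Data.Fin.Base using (Fin)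
open import Data.Integer.Base using (ℤ; +_)
open import Data.Integer.Divisibility.Signed using (_∣_; _∣?_)
open import Data.List.Base using (length; filter; upTo)
open import Data.Nat.Base using (ℕ; suc)
open import Data.Rational.Base using (ℚ; _/_; _+_; ½; floor)
open import Function.Bundles using (_↔_)
open import Relation.Nullary.Decidable using (¬?)
open import Relation.Nullary.Negation using (¬_)
open import Relation.Unary using (Pred; Decidable)

-- Half-integers go up, also for negative x, where the library's `round`
-- sends them away from zero.
nint : ℚ → ℤ
nint x = floor (x + ½)

Odd : Pred ℤ _
Odd z = ¬ (+ 2 ∣ z)

odd? : Decidable Odd
odd? z = ¬? (+ 2 ∣? z)

-- upTo n lists 0, …, n - 1, so k = suc i runs over 1, …, n.
𝓡 : ℕ → ℕ
𝓡 n = length (filter (λ i → odd? (nint (+ n / suc i))) (upTo n))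

-- When A is a Σ-type cutting out a subset, this counts elements of the subset
-- only if the defining predicate is proof-irrelevant, as ≤ on ℤ is.
HasCardinality : Set → ℕ → Set
HasCardinality A m = A ↔ Fin m

{-# OPTIONS --safe #-}

-- Summing r₂(m) = 4 Σ_{dδ = m} χ(δ) over 1 ≤ m ≤ 2n, with χ the character modulo 4, gives
-- 4 Σ_d H(⌊2n/d⌋), where H(q) = Σ_{δ ≤ q} χ(δ) is 1 if ⌊(q + 1)/2⌋ is odd and 0 otherwise. Since
-- nint(n/d) = ⌊(⌊2n/d⌋ + 1)/2⌋, the terms with d ≤ n contribute 𝓡 n, and those with n < d ≤ 2n one each.
--
-- Jacobi's formula for r₂ follows Liouville and Uspensky. Both sides, with value 1 at 0, satisfy the recurrence
-- Σ_i (n − 3i²) r(n − i²) = 0, which determines r: for r₂ by the symmetry of i² + j² + k² = n, for the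
-- divisor sum because it equals Σ χ(δ)(δ − 2i)(d + i) over i² + dδ = n with d, δ > 0, where linear
-- involutions reversing the sign of the summand cancel everything but the solutions with
-- d = δ − 2i. These exist only if n = (d + i)² and give the terms of the recurrence containing r(0).

module Submission where

open import Data.Bool.Base using (if_then_else_)
open import Data.Fin.Base as Fin using (Fin)
open import Data.Integer.Base hiding (suc; NonZero)
open import Data.Integer.Divisibility.Signed using (∣m∣n⇒∣m+n; ∣m+n∣m⇒∣n; divides)
open import Data.Integer.Properties
open import Data.Integer.Tactic.RingSolver using (solve-∀)
open import Data.List.Base
  using (List; []; _∷_; _++_; map; filter; cartesianProduct; upTo; applyUpTo; length; lookup)
open import Data.List.Properties using (map-upTo)
open import Data.List.Membership.Propositional using (_∈_)
open import Data.List.Membership.Propositional.Properties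
open import Data.List.Membership.Propositional.Properties.WithK using (unique∧set⇒bag)
open import Data.List.Relation.Binary.BagAndSetEquality using (∼bag⇒↭)
open import Data.List.Relation.Binary.Permutation.Propositional as ↭ using (_↭_)
open import Data.List.Relation.Unary.All as All using ()
import Data.List.Relation.Unary.All.Properties as All
open import Data.List.Relation.Unary.Any using (here; there; index)
open import Data.List.Relation.Unary.Any.Properties using (lookup-index)
open import Data.List.Relation.Unary.Unique.Propositional using (Unique; []; _∷_)
import Data.List.Relation.Unary.Unique.Propositional.Properties as Unique
open import Data.Nat.Base as ℕ using (ℕ; suc; zero; z≤n; s≤s; NonZero)
import Data.Nat.Divisibility as ℕ
open import Data.Nat.DivMod as ℕ
  using (m/n*n≤m; m*n/n≡m; /-monoˡ-≤; m/n≤m; m/n≡1+[m∸n]/n; m<n⇒m/n≡0; m*n/o*n≡m/o; m/n/o≡m/[n*o]; +-distrib-/-∣ʳ)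
open import Data.Nat.Induction using (<-rec)
import Data.Nat.Properties as ℕ
open import Data.Product.Base using (_×_; _,_; ∃; Σ; Σ-syntax; proj₁; proj₂)
import Data.Rational.Base as ℚ
import Data.Rational.Properties as ℚ
import Data.Rational.Unnormalised.Base as ℚᵘ
import Data.Rational.Unnormalised.Properties as ℚᵘ
open import Data.Sum.Base using ([_,_]′)
open import Function.Base using (_∘_; id; case_of_)
open import Function.Bundles using (mk⇔; mk↔ₛ′)
open import Level using (Level)
open import Relation.Binary.Definitions using (tri<; tri≈; tri>)
open import Relation.Binary.PropositionalEquality
open import Relation.Nullary using (Dec; yes; no; ¬_; Irrelevant)
open import Relation.Nullary.Decidable using (does; _×-dec_)
open import Relation.Nullary.Negation using (contradiction)
open import Relation.Unary using (Pred; Decidable)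
open import Defs

-- The factor n - 3i² has its origin in a differential equation. With θ = Σ q^(i²), F = θ² and D = q
-- d/dq one has θ·DF = 2·Dθ·F; comparing coefficients of q^n gives Σ_i (n - i²) r(n - i²) = 2 Σ_i i²
-- r(n - i²). The equation is linear of first order in F, so F is determined by its constant term.
--
-- Each involution changes the sign of one variable in a diagonal quadratic form, and the weight is
-- odd under all three sign changes. In general none of them keeps d and δ positive on every
-- solution. The solutions are therefore cut into regions, according to which sign change keeps both
-- positive.
--
-- All sums are finite sums over lists: the coordinates run through a box of size M, which is 2n in
-- the end, and conditions become indicator factors. One fixed box serves all arguments m ≤ M at
-- once, so that a recurrence relates values of one and the same function. The involutions act on
-- the solutions inside the box, not on the box.

private
  variable
    ℓ₁ ℓ₂ ℓ₃ : Level
    A : Set ℓ₁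
    B : Set ℓ₂
    P Q : Set ℓ₃

-- Integers

i<j⇒0<j-i : ∀ {i j} → i < j → 0ℤ < j - i
i<j⇒0<j-i {i} {j} i<j = subst (_< j - i) (+-inverseʳ i) (+-monoˡ-< (- i) i<j)

0<j-i⇒i<j : ∀ {i j} → 0ℤ < j - i → i < j
0<j-i⇒i<j {i} {j} 0<j-i = subst₂ _<_ (+-identityˡ i) (lemma j i) (+-monoˡ-< i 0<j-i)
  where
  lemma : ∀ j i → j - i + i ≡ j
  lemma = solve-∀

square : ∀ z → z * z ≡ + (∣ z ∣ ℕ.* ∣ z ∣)
square (+ n)    = sym (pos-* n n)
square -[1+ n ] = refl

k≤k*k : ∀ k → k ℕ.≤ k ℕ.* k
k≤k*k zero    = z≤n
k≤k*k (suc k) = ℕ.m≤m*n (suc k) (suc k)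

pos-subst : ∀ {x y} → x ≡ y → 0ℤ < x → 0ℤ < y
pos-subst = subst (0ℤ <_)

0<i+i⇒0<i : ∀ {i} → 0ℤ < i + i → 0ℤ < i
0<i+i⇒0<i {+ zero}   (+<+ ())
0<i+i⇒0<i {+[1+ _ ]} _ = +<+ ℕ.z<s

x+y≡z⇒y≡z-x : ∀ {x y z} → x + y ≡ z → y ≡ z - x
x+y≡z⇒y≡z-x {x} {y} refl = lemma x y
  where
  lemma : ∀ x y → y ≡ x + y - x
  lemma = solve-∀

y≡z-x⇒x+y≡z : ∀ {x y z} → y ≡ z - x → x + y ≡ z
y≡z-x⇒x+y≡z {x} {_} {z} refl = lemma x z
  where
  lemma : ∀ x z → x + (z - x) ≡ z
  lemma = solve-∀

i²≥1 : ∀ i → i ≢ 0ℤ → ∃ λ k → i * i ≡ +[1+ k ]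
i²≥1 +0       i≢0 = contradiction refl i≢0
i²≥1 +[1+ k ] _   = _ , refl
i²≥1 -[1+ k ] _   = _ , refl

x≡-x⇒x≡0 : ∀ {x} → x ≡ - x → x ≡ 0ℤ
x≡-x⇒x≡0 {+ zero} eq = refl

-- Indicators and finite sums

𝟙 : Dec P → ℤ
𝟙 p? = if does p? then 1ℤ else 0ℤ

𝟙-cong : (p? : Dec P) (q? : Dec Q) → (P → Q) → (Q → P) → 𝟙 p? ≡ 𝟙 q?
𝟙-cong (yes p) (yes q) f g = refl
𝟙-cong (yes p) (no ¬q) f g = contradiction (f p) ¬q
𝟙-cong (no ¬p) (yes q) f g = contradiction (g q) ¬p
𝟙-cong (no ¬p) (no ¬q) f g = refl

𝟙-yes : (p? : Dec P) → P → 𝟙 p? ≡ 1ℤ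
𝟙-yes (yes _) p = refl
𝟙-yes (no ¬p) p = contradiction p ¬p

𝟙-no : (p? : Dec P) → ¬ P → 𝟙 p? ≡ 0ℤ
𝟙-no (yes p) ¬p = contradiction p ¬p
𝟙-no (no _)  ¬p = refl

-- This is how the equation that defines a solution set gets used inside a sum over the whole box.
𝟙*-cong : (p? : Dec P) {x y : ℤ} → (P → x ≡ y) → 𝟙 p? * x ≡ 𝟙 p? * y
𝟙*-cong (yes p) f = cong (1ℤ *_) (f p)
𝟙*-cong (no _)  f = refl

𝟙-× : (p? : Dec P) (q? : Dec Q) → 𝟙 (p? ×-dec q?) ≡ 𝟙 p? * 𝟙 q?
𝟙-× (yes _) (yes _) = refl
𝟙-× (yes _) (no _)  = refl
𝟙-× (no _)  (yes _) = refl
𝟙-× (no _)  (no _)  = refl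

∑ : List A → (A → ℤ) → ℤ
∑ []       f = 0ℤ
∑ (x ∷ xs) f = f x + ∑ xs f

∑-cong∈ : ∀ (xs : List A) {f g} → (∀ {x} → x ∈ xs → f x ≡ g x) → ∑ xs f ≡ ∑ xs g
∑-cong∈ []       f≗g = refl
∑-cong∈ (x ∷ xs) f≗g = cong₂ _+_ (f≗g (here refl)) (∑-cong∈ xs (f≗g ∘ there))

∑-cong : ∀ (xs : List A) {f g} → (∀ x → f x ≡ g x) → ∑ xs f ≡ ∑ xs g
∑-cong xs f≗g = ∑-cong∈ xs (λ {x} _ → f≗g x)

∑-zero : ∀ (xs : List A) → ∑ xs (λ _ → 0ℤ) ≡ 0ℤ
∑-zero []       = refl
∑-zero (x ∷ xs) = trans (+-identityˡ _) (∑-zero xs)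

∑-distrib-+ : ∀ (xs : List A) f g → ∑ xs (λ x → f x + g x) ≡ ∑ xs f + ∑ xs g
∑-distrib-+ []       f g = refl
∑-distrib-+ (x ∷ xs) f g = trans (cong (_+_ (f x + g x)) (∑-distrib-+ xs f g)) (lemma (f x) (g x) _ _)
  where
  lemma : ∀ a b c d → (a + b) + (c + d) ≡ (a + c) + (b + d)
  lemma = solve-∀

*-distribˡ-∑ : ∀ c (xs : List A) f → c * ∑ xs f ≡ ∑ xs (λ x → c * f x)
*-distribˡ-∑ c []       f = *-zeroʳ c
*-distribˡ-∑ c (x ∷ xs) f =
  trans (*-distribˡ-+ c (f x) (∑ xs f)) (cong (_+_ (c * f x)) (*-distribˡ-∑ c xs f))

∑-neg : ∀ (xs : List A) f → ∑ xs (λ x → - f x) ≡ - ∑ xs f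
∑-neg []       f = refl
∑-neg (x ∷ xs) f = trans (cong (_+_ (- f x)) (∑-neg xs f)) (sym (neg-distrib-+ (f x) _))

∑-swap : ∀ (xs : List A) (ys : List B) (f : A → B → ℤ) →
         ∑ xs (λ x → ∑ ys (f x)) ≡ ∑ ys (λ y → ∑ xs (λ x → f x y))
∑-swap []       ys f = sym (∑-zero ys)
∑-swap (x ∷ xs) ys f =
  trans (cong (_+_ (∑ ys (f x))) (∑-swap xs ys f)) (sym (∑-distrib-+ ys (f x) _))

∑-++ : ∀ (xs ys : List A) f → ∑ (xs ++ ys) f ≡ ∑ xs f + ∑ ys f
∑-++ []       ys f = sym (+-identityˡ _)
∑-++ (x ∷ xs) ys f = trans (cong (_+_ (f x)) (∑-++ xs ys f)) (sym (+-assoc (f x) _ _))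

∑-map : ∀ (φ : A → B) xs f → ∑ (map φ xs) f ≡ ∑ xs (f ∘ φ)
∑-map φ []       f = refl
∑-map φ (x ∷ xs) f = cong (_+_ (f (φ x))) (∑-map φ xs f)

∑-↭ : ∀ {xs ys : List A} f → xs ↭ ys → ∑ xs f ≡ ∑ ys f
∑-↭ f ↭.refl = refl
∑-↭ f (↭.prep x p) = cong (_+_ (f x)) (∑-↭ f p)
∑-↭ f (↭.swap x y p) = trans (cong (λ t → f x + (f y + t)) (∑-↭ f p)) (lemma (f x) (f y) _)
  where
  lemma : ∀ a b c → a + (b + c) ≡ b + (a + c)
  lemma = solve-∀
∑-↭ f (↭.trans p q) = trans (∑-↭ f p) (∑-↭ f q)

∑-filter : ∀ {P : Pred A ℓ₃} (P? : Decidable P) xs f →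
           ∑ (filter P? xs) f ≡ ∑ xs (λ x → 𝟙 (P? x) * f x)
∑-filter P? []       f = refl
∑-filter P? (x ∷ xs) f with P? x
... | yes _ = cong₂ _+_ (sym (*-identityˡ (f x))) (∑-filter P? xs f)
... | no  _ = trans (∑-filter P? xs f) (sym (+-identityˡ _))

∑-cartesianProduct : ∀ (xs : List A) (ys : List B) f →
                     ∑ (cartesianProduct xs ys) f ≡ ∑ xs (λ x → ∑ ys (λ y → f (x , y)))
∑-cartesianProduct []       ys f = refl
∑-cartesianProduct (x ∷ xs) ys f =
  trans (∑-++ (map (x ,_) ys) _ f) (cong₂ _+_ (∑-map (x ,_) ys f) (∑-cartesianProduct xs ys f))

map-unique : ∀ (φ : A → B) {xs} → (∀ {x y} → x ∈ xs → y ∈ xs → φ x ≡ φ y → x ≡ y) →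
             Unique xs → Unique (map φ xs)
map-unique φ inj []             = []
map-unique φ inj (x∉xs ∷ xs!) =
  All.map⁺ (All.tabulate λ y∈xs φx≡φy → All.lookup x∉xs y∈xs (inj (here refl) (there y∈xs) φx≡φy))
  ∷ map-unique φ (λ x∈ y∈ → inj (there x∈) (there y∈)) xs!

-- Duplicate-free lists with the same members are permutations of each other, and a sum ignores
-- order. The maps have to be inverse only on members, which allows formulas that make sense on
-- solutions alone.
∑-bijection : ∀ {xs : List A} {ys : List B} → Unique xs → Unique ys → (φ : A → B) (ψ : B → A) →
              (∀ {x} → x ∈ xs → φ x ∈ ys) → (∀ {y} → y ∈ ys → ψ y ∈ xs) →
              (∀ {x} → x ∈ xs → ψ (φ x) ≡ x) → (∀ {y} → y ∈ ys → φ (ψ y) ≡ y) →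
              ∀ f → ∑ xs (f ∘ φ) ≡ ∑ ys f
∑-bijection {xs = xs} {ys} xs! ys! φ ψ φ∈ ψ∈ ψφ φψ f =
  trans (sym (∑-map φ xs f)) (∑-↭ f (∼bag⇒↭ (unique∧set⇒bag (map-unique φ inj xs!) ys! (mk⇔ to from))))
  where
  inj : ∀ {x y} → x ∈ xs → y ∈ xs → φ x ≡ φ y → x ≡ y
  inj x∈ y∈ eq = trans (sym (ψφ x∈)) (trans (cong ψ eq) (ψφ y∈))
  to : ∀ {z} → z ∈ map φ xs → z ∈ ys
  to z∈ with _ , x∈ , refl ← ∈-map⁻ φ z∈ = φ∈ x∈
  from : ∀ {z} → z ∈ ys → z ∈ map φ xs
  from z∈ = subst (_∈ map φ xs) (φψ z∈) (∈-map⁺ φ (ψ∈ z∈))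

-- A sum over a set with a sign-reversing involution is its own negative.
∑-involution : ∀ {xs : List A} → Unique xs → {P : Pred A ℓ₃} (P? : Decidable P) →
               (∀ {x} → P x → x ∈ xs) → (σ : A → A) → (∀ x → σ (σ x) ≡ x) →
               (∀ {x} → P x → P (σ x)) → ∀ f → (∀ {x} → P x → f (σ x) ≡ - f x) →
               ∑ xs (λ x → 𝟙 (P? x) * f x) ≡ 0ℤ
∑-involution {xs = xs} xs! {P} P? P⊆ σ σσ Pσ f fσ = trans (sym (∑-filter P? xs f)) (x≡-x⇒x≡0 self-neg)
  where
  ys = filter P? xs
  P-of : ∀ {x} → x ∈ ys → P x
  P-of x∈ with _ , px ← ∈-filter⁻ P? {xs = xs} x∈ = px
  -- The list `xs` is not assumed stable under `σ`: the image satisfies `P`, and `P⊆` puts it back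
  -- into the list.
  σ∈ : ∀ {x} → x ∈ ys → σ x ∈ ys
  σ∈ x∈ = ∈-filter⁺ P? (P⊆ (Pσ (P-of x∈))) (Pσ (P-of x∈))
  ys! = Unique.filter⁺ P? xs!
  self-neg : ∑ ys f ≡ - ∑ ys f
  self-neg = begin
    ∑ ys f              ≡⟨ ∑-bijection ys! ys! σ σ σ∈ σ∈ (λ _ → σσ _) (λ _ → σσ _) f ⟨
    ∑ ys (f ∘ σ)        ≡⟨ ∑-cong∈ ys (fσ ∘ P-of) ⟩
    ∑ ys (λ x → - f x)  ≡⟨ ∑-neg ys f ⟩
    - ∑ ys f            ∎
    where open ≡-Reasoning

∑-antisym : ∀ (xs : List A) (f : A → A → ℤ) → (∀ x y → f x y ≡ - f y x) →
            ∑ xs (λ x → ∑ xs (f x)) ≡ 0ℤ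
∑-antisym xs f anti = x≡-x⇒x≡0 (begin
  ∑ xs (λ x → ∑ xs (f x))               ≡⟨ ∑-swap xs xs f ⟩
  ∑ xs (λ y → ∑ xs (λ x → f x y))       ≡⟨ ∑-cong xs (λ y → ∑-cong xs (λ x → anti x y)) ⟩
  ∑ xs (λ y → ∑ xs (λ x → - f y x))     ≡⟨ ∑-cong xs (λ y → ∑-neg xs (f y)) ⟩
  ∑ xs (λ y → - ∑ xs (f y))             ≡⟨ ∑-neg xs (λ y → ∑ xs (f y)) ⟩
  - ∑ xs (λ x → ∑ xs (f x))             ∎)
  where open ≡-Reasoning

length-filter : ∀ {P : Pred A ℓ₃} (P? : Decidable P) xs → + length (filter P? xs) ≡ ∑ xs (λ x → 𝟙 (P? x))
length-filter P? []       = refl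
length-filter P? (x ∷ xs) with P? x
... | yes _ = cong (_+_ 1ℤ) (length-filter P? xs)
... | no  _ = trans (length-filter P? xs) (sym (+-identityˡ _))

∑< : ℕ → (ℕ → ℤ) → ℤ
∑< zero    f = 0ℤ
∑< (suc n) f = f 0 + ∑< n (f ∘ suc)

∑-upTo : ∀ n f → ∑ (upTo n) f ≡ ∑< n f
∑-upTo zero    f = refl
∑-upTo (suc n) f = cong (_+_ (f 0)) (begin
  ∑ (applyUpTo suc n) f    ≡⟨ cong (λ xs → ∑ xs f) (map-upTo suc n) ⟨
  ∑ (map suc (upTo n)) f   ≡⟨ ∑-map suc (upTo n) f ⟩
  ∑ (upTo n) (f ∘ suc)     ≡⟨ ∑-upTo n (f ∘ suc) ⟩
  ∑< n (f ∘ suc)           ∎)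
  where open ≡-Reasoning

∑<-cong< : ∀ n {f g : ℕ → ℤ} → (∀ {k} → k ℕ.< n → f k ≡ g k) → ∑< n f ≡ ∑< n g
∑<-cong< zero    f≗g = refl
∑<-cong< (suc n) f≗g = cong₂ _+_ (f≗g ℕ.z<s) (∑<-cong< n (f≗g ∘ ℕ.s<s))

∑<-cong : ∀ n {f g : ℕ → ℤ} → (∀ k → f k ≡ g k) → ∑< n f ≡ ∑< n g
∑<-cong n f≗g = ∑<-cong< n (λ _ → f≗g _)

∑<-zero : ∀ n → ∑< n (λ _ → 0ℤ) ≡ 0ℤ
∑<-zero zero    = refl
∑<-zero (suc n) = trans (+-identityˡ _) (∑<-zero n)

-- Turns an upper bound on the index, which a sum over a box carries as an indicator, into the
-- length of the sum.
∑<-truncate : ∀ {q n} → q ℕ.≤ n → ∀ f → ∑< n (λ k → 𝟙 (k ℕ.<? q) * f k) ≡ ∑< q f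
∑<-truncate {n = n} z≤n f = trans (∑<-cong n (λ k → cong (_* f k) (𝟙-no (k ℕ.<? 0) λ ()))) (∑<-zero n)
∑<-truncate {suc q} {suc n} (s≤s q≤n) f = cong₂ _+_ (*-identityˡ (f 0)) (begin
  ∑< n (λ k → 𝟙 (suc k ℕ.<? suc q) * f (suc k))
    ≡⟨ ∑<-cong n (λ k → cong (_* f (suc k)) (𝟙-cong (suc k ℕ.<? suc q) (k ℕ.<? q) ℕ.s<s⁻¹ ℕ.s<s)) ⟩
  ∑< n (λ k → 𝟙 (k ℕ.<? q) * f (suc k))          ≡⟨ ∑<-truncate q≤n (f ∘ suc) ⟩
  ∑< q (f ∘ suc)                                 ∎)
  where open ≡-Reasoning

∑<-+ : ∀ m n f → ∑< (m ℕ.+ n) f ≡ ∑< m f + ∑< n (λ k → f (m ℕ.+ k))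
∑<-+ zero    n f = sym (+-identityˡ _)
∑<-+ (suc m) n f = trans (cong (_+_ (f 0)) (∑<-+ m n (f ∘ suc))) (sym (+-assoc (f 0) _ _))

∑<-one : ∀ n → ∑< n (λ _ → 1ℤ) ≡ + n
∑<-one zero    = refl
∑<-one (suc n) = cong (_+_ 1ℤ) (∑<-one n)

∑<-𝟙≡ : ∀ k q → ∑< q (λ m → 𝟙 (k ℕ.≟ m)) ≡ 𝟙 (k ℕ.<? q)
∑<-𝟙≡ k       zero    = refl
∑<-𝟙≡ zero    (suc q) = cong (_+_ 1ℤ) (∑<-zero q)
∑<-𝟙≡ (suc k) (suc q) = begin
  0ℤ + ∑< q (λ m → 𝟙 (suc k ℕ.≟ suc m))   ≡⟨ +-identityˡ _ ⟩
  ∑< q (λ m → 𝟙 (suc k ℕ.≟ suc m))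
    ≡⟨ ∑<-cong q (λ m → 𝟙-cong (suc k ℕ.≟ suc m) (k ℕ.≟ m) ℕ.suc-injective (cong suc)) ⟩
  ∑< q (λ m → 𝟙 (k ℕ.≟ m))                ≡⟨ ∑<-𝟙≡ k q ⟩
  𝟙 (k ℕ.<? q)                            ≡⟨ 𝟙-cong (k ℕ.<? q) (suc k ℕ.<? suc q) ℕ.s<s ℕ.s<s⁻¹ ⟩
  𝟙 (suc k ℕ.<? suc q)                    ∎
  where open ≡-Reasoning

-- Cuts a sublevel set into level sets. A negative `z` would lie below `N` without being equal to
-- any index.
∑-𝟙≡ : ∀ {z} N → 0ℤ ≤ z → ∑ (upTo (suc N)) (λ m → 𝟙 (z ≟ + m)) ≡ 𝟙 (z ≤? + N)
∑-𝟙≡ {+ k} N _ = begin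
  ∑ (upTo (suc N)) (λ m → 𝟙 (+ k ≟ + m))   ≡⟨ ∑-upTo (suc N) (λ m → 𝟙 (+ k ≟ + m)) ⟩
  ∑< (suc N) (λ m → 𝟙 (+ k ≟ + m))
    ≡⟨ ∑<-cong (suc N) (λ m → 𝟙-cong (+ k ≟ + m) (k ℕ.≟ m) +-injective (cong (λ k → + k))) ⟩
  ∑< (suc N) (λ m → 𝟙 (k ℕ.≟ m))           ≡⟨ ∑<-𝟙≡ k (suc N) ⟩
  𝟙 (k ℕ.<? suc N)
    ≡⟨ 𝟙-cong (k ℕ.<? suc N) (+ k ≤? + N) (+≤+ ∘ ℕ.s≤s⁻¹) (s≤s ∘ drop‿+≤+) ⟩
  𝟙 (+ k ≤? + N)                           ∎
  where open ≡-Reasoning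

-- The character modulo 4

χℕ : ℕ → ℤ
χℕ 0 = 0ℤ
χℕ 1 = 1ℤ
χℕ 2 = 0ℤ
χℕ 3 = -1ℤ
χℕ (suc (suc (suc (suc n)))) = χℕ n

-- The odd extension, which is 4-periodic on all of ℤ because χ(4 - n) = -χ(n). Negative arguments
-- do occur: one involution replaces δ by 4(d + i) - δ, handled as the negative of δ - 4(d + i).
χ : ℤ → ℤ
χ (+ n)    = χℕ n
χ -[1+ n ] = - χℕ (suc n)

χ-neg : ∀ z → χ (- z) ≡ - χ z
χ-neg +0       = refl
χ-neg +[1+ n ] = refl
χ-neg -[1+ n ] = sym (neg-involutive (χℕ (suc n)))

χ-4+ : ∀ z → χ (+ 4 + z) ≡ χ z
χ-4+ (+ n)    = refl
χ-4+ -[1+ 0 ] = refl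
χ-4+ -[1+ 1 ] = refl
χ-4+ -[1+ 2 ] = refl
χ-4+ -[1+ 3 ] = refl
χ-4+ -[1+ suc (suc (suc (suc n))) ] = refl

χ-periodic⁺ : ∀ k z → χ (z + + 4 * + k) ≡ χ z
χ-periodic⁺ zero    z = cong χ (+-identityʳ z)
χ-periodic⁺ (suc k) z = begin
  χ (z + + 4 * + suc k)           ≡⟨ cong χ (lemma z (+ k)) ⟩
  χ (+ 4 + (z + + 4 * + k))       ≡⟨ χ-4+ (z + + 4 * + k) ⟩
  χ (z + + 4 * + k)               ≡⟨ χ-periodic⁺ k z ⟩
  χ z                             ∎
  where
  open ≡-Reasoning
  lemma : ∀ z k → z + + 4 * (1ℤ + k) ≡ + 4 + (z + + 4 * k)
  lemma = solve-∀

χ-periodic : ∀ z k → χ (z - + 4 * k) ≡ χ z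
χ-periodic z (+ k) = trans (sym (χ-periodic⁺ k (z - + 4 * + k))) (cong χ (lemma z (+ k)))
  where
  lemma : ∀ z k → z - + 4 * k + + 4 * k ≡ z
  lemma = solve-∀
χ-periodic z -[1+ k ] = trans (cong χ (lemma z (+ suc k))) (χ-periodic⁺ (suc k) z)
  where
  lemma : ∀ z k → z - + 4 * (- k) ≡ z + + 4 * k
  lemma = solve-∀

-- With s = t + 1 and δ = k + 1 this reads Σ χ(δ)(2s - δ) = s over 0 < δ < 2s. Raising s by 2
-- prepends four terms, of which (q + 4) - (q + 2) = 2 survives; by periodicity the remaining ones
-- form the old sum.
∑χ-weighted : ∀ t → ∑< (suc (t ℕ.+ t)) (λ k → χℕ (suc k) * (+ suc (t ℕ.+ t) - + k)) ≡ + suc t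
∑χ-weighted zero          = refl
∑χ-weighted (suc zero)    = refl
∑χ-weighted (suc (suc t)) = begin
  U (suc (suc (suc t) ℕ.+ suc (suc t)))       ≡⟨ cong U (cong suc eq) ⟩
  U (4 ℕ.+ q)                                 ≡⟨ step q ⟩
  + 2 + U q                                   ≡⟨ cong (_+_ (+ 2)) (∑χ-weighted t) ⟩
  + suc (suc (suc t))                         ∎
  where
  open ≡-Reasoning
  q = suc (t ℕ.+ t)
  U : ℕ → ℤ
  U q = ∑< q (λ k → χℕ (suc k) * (+ q - + k))
  eq : suc (suc t) ℕ.+ suc (suc t) ≡ 4 ℕ.+ (t ℕ.+ t)
  eq = cong (suc ∘ suc) (trans (ℕ.+-suc t (suc t)) (cong suc (ℕ.+-suc t t)))
  collect : ∀ q u → 1ℤ * (+ 4 + q - + 0) + (0ℤ * (+ 4 + q - + 1) + (-1ℤ * (+ 4 + q - + 2) + (0ℤ * (+ 4 + q - + 3) + u)))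
                    ≡ + 2 + u
  collect = solve-∀
  shift : ∀ q k → + 4 + q - (+ 4 + k) ≡ q - k
  shift = solve-∀
  step : ∀ q → U (4 ℕ.+ q) ≡ + 2 + U q
  step q = trans (collect (+ q) (∑< q λ k → χℕ (suc k) * (+ (4 ℕ.+ q) - + (4 ℕ.+ k))))
    (cong (_+_ (+ 2)) (∑<-cong q λ k → cong (χℕ (suc k) *_) (shift (+ q) (+ k))))

-- Rounding, and `𝓡` as a sum of character sums

-- Rational arithmetic returns a reduced fraction of unknown shape. Expanding both fractions to a
-- common denominator shows that the natural quotient does not depend on the representative.
floor-/ : ∀ (q : ℚ.ℚ) b c → ℚ.toℚᵘ q ℚᵘ.≃ ℚᵘ.mkℚᵘ (+ b) c → ℚ.floor q ≡ + (b ℕ./ suc c)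
floor-/ (ℚ.mkℚ (+ x) y _) b c (ℚᵘ.*≡* eq) = trans (*-identityˡ (+ (x ℕ./ suc y))) (cong (λ k → + k) (begin
  x ℕ./ suc y                        ≡⟨ m*n/o*n≡m/o x (suc c) (suc y) ⟨
  x ℕ.* suc c ℕ./ (suc y ℕ.* suc c)  ≡⟨ cong (ℕ._/ (suc y ℕ.* suc c)) eqℕ ⟩
  b ℕ.* suc y ℕ./ (suc y ℕ.* suc c)  ≡⟨ ℕ./-congʳ {m = b ℕ.* suc y} (ℕ.*-comm (suc y) (suc c)) ⟩
  b ℕ.* suc y ℕ./ (suc c ℕ.* suc y)  ≡⟨ m*n/o*n≡m/o b (suc y) (suc c) ⟩
  b ℕ./ suc c                        ∎))
  where
  open ≡-Reasoning
  eqℕ : x ℕ.* suc c ≡ b ℕ.* suc y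
  eqℕ = +-injective (trans (pos-* x (suc c)) (trans eq (sym (pos-* b (suc y)))))
floor-/ (ℚ.mkℚ -[1+ x ] y _) b c (ℚᵘ.*≡* eq) with () ← trans eq (sym (pos-* b (suc y)))

-- For k = i + 1, m/k + 1/2 = (2m + k)/(2k), and floor division by 2k is division by k followed by
-- division by 2.
nint-/ : ∀ m i → nint (+ m ℚ./ suc i) ≡ + (suc (2 ℕ.* m ℕ./ suc i) ℕ./ 2)
nint-/ m i = trans (floor-/ (+ m ℚ./ suc i ℚ.+ ℚ.½) (m ℕ.* 2 ℕ.+ suc i) (ℕ.pred (suc i ℕ.* 2)) half)
                   (cong (λ k → + k) (begin
  (m ℕ.* 2 ℕ.+ suc i) ℕ./ (suc i ℕ.* 2)     ≡⟨ m/n/o≡m/[n*o] (m ℕ.* 2 ℕ.+ suc i) (suc i) 2 ⟨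
  (m ℕ.* 2 ℕ.+ suc i) ℕ./ suc i ℕ./ 2       ≡⟨ cong (ℕ._/ 2) (begin
    (m ℕ.* 2 ℕ.+ suc i) ℕ./ suc i             ≡⟨ +-distrib-/-∣ʳ (m ℕ.* 2) ℕ.∣-refl ⟩
    m ℕ.* 2 ℕ./ suc i ℕ.+ suc i ℕ./ suc i
      ≡⟨ cong₂ ℕ._+_ (cong (ℕ._/ suc i) (ℕ.*-comm m 2)) (ℕ.n/n≡1 (suc i)) ⟩
    2 ℕ.* m ℕ./ suc i ℕ.+ 1                   ≡⟨ ℕ.+-comm _ 1 ⟩
    suc (2 ℕ.* m ℕ./ suc i)                   ∎) ⟩
  suc (2 ℕ.* m ℕ./ suc i) ℕ./ 2             ∎))
  where
  open ≡-Reasoning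
  num : + m * + 2 + 1ℤ * + suc i ≡ + (m ℕ.* 2 ℕ.+ suc i)
  num = cong₂ _+_ (sym (pos-* m 2)) (*-identityˡ (+ suc i))
  half : ℚ.toℚᵘ (+ m ℚ./ suc i ℚ.+ ℚ.½) ℚᵘ.≃ ℚᵘ.mkℚᵘ (+ (m ℕ.* 2 ℕ.+ suc i)) (ℕ.pred (suc i ℕ.* 2))
  half = ℚᵘ.≃-trans (ℚ.toℚᵘ-homo-+ (+ m ℚ./ suc i) ℚ.½)
    (ℚᵘ.≃-trans (ℚᵘ.+-congˡ (ℚ.toℚᵘ ℚ.½) (ℚ.toℚᵘ-fromℚᵘ (ℚᵘ.mkℚᵘ (+ m) i)))
      (ℚᵘ.≃-reflexive (cong (λ z → ℚᵘ.mkℚᵘ z (ℕ.pred (suc i ℕ.* 2))) num)))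

-- Both sides have period 4 in `q`: χ sums to zero over a full period, and ⌊(q + 1)/2⌋ grows by 2,
-- which keeps its parity.
∑χ-odd : ∀ q → ∑< q (χℕ ∘ suc) ≡ 𝟙 (odd? (+ (suc q ℕ./ 2)))
∑χ-odd 0 = refl
∑χ-odd 1 = refl
∑χ-odd 2 = refl
∑χ-odd 3 = refl
∑χ-odd (suc (suc (suc (suc q)))) = begin
  1ℤ + (0ℤ + (-1ℤ + (0ℤ + ∑< q (χℕ ∘ suc))))   ≡⟨ collect (∑< q (χℕ ∘ suc)) ⟩
  ∑< q (χℕ ∘ suc)                              ≡⟨ ∑χ-odd q ⟩
  𝟙 (odd? (+ h))
    ≡⟨ 𝟙-cong (odd? (+ h)) (odd? (+ 2 + + h)) (λ odd even → odd (∣m+n∣m⇒∣n even (divides 1ℤ refl)))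
                                              (λ odd even → odd (∣m∣n⇒∣m+n (divides 1ℤ refl) even)) ⟩
  𝟙 (odd? (+ (2 ℕ.+ h)))
    ≡⟨ cong (λ h → 𝟙 (odd? (+ h))) (trans (m/n≡1+[m∸n]/n {5 ℕ.+ q} (s≤s (s≤s z≤n)))
         (cong suc (m/n≡1+[m∸n]/n {3 ℕ.+ q} (s≤s (s≤s z≤n))))) ⟨
  𝟙 (odd? (+ ((5 ℕ.+ q) ℕ./ 2)))               ∎
  where
  open ≡-Reasoning
  h = suc q ℕ./ 2
  collect : ∀ s → 1ℤ + (0ℤ + (-1ℤ + (0ℤ + s))) ≡ s
  collect = solve-∀

+𝓡 : ∀ n → + 𝓡 n ≡ ∑< n (λ i → ∑< (2 ℕ.* n ℕ./ suc i) (χℕ ∘ suc))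
+𝓡 n = begin
  + 𝓡 n                                                ≡⟨ length-filter odd-nint? (upTo n) ⟩
  ∑ (upTo n) (λ i → 𝟙 (odd-nint? i))                   ≡⟨ ∑-upTo n (λ i → 𝟙 (odd-nint? i)) ⟩
  ∑< n (λ i → 𝟙 (odd-nint? i))                         ≡⟨ ∑<-cong n (λ i → cong (λ z → 𝟙 (odd? z)) (nint-/ n i)) ⟩
  ∑< n (λ i → 𝟙 (odd? (+ (suc (2 ℕ.* n ℕ./ suc i) ℕ./ 2))))
    ≡⟨ ∑<-cong n (λ i → ∑χ-odd (2 ℕ.* n ℕ./ suc i)) ⟨
  ∑< n (λ i → ∑< (2 ℕ.* n ℕ./ suc i) (χℕ ∘ suc))       ∎
  where
  open ≡-Reasoning
  odd-nint? : Decidable (λ i → Odd (nint (+ n ℚ./ suc i)))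
  odd-nint? i = odd? (nint (+ n ℚ./ suc i))

∑-quotients : ∀ n → ∑< (2 ℕ.* n) (λ j → ∑< (2 ℕ.* n ℕ./ suc j) (χℕ ∘ suc)) ≡ + 𝓡 n + + n
∑-quotients n = begin
  ∑< (2 ℕ.* n) F                       ≡⟨ ∑<-+ n (n ℕ.+ 0) F ⟩
  ∑< n F + ∑< (n ℕ.+ 0) (λ k → F (n ℕ.+ k))
    ≡⟨ cong₂ (λ s m → s + ∑< m (λ k → F (n ℕ.+ k))) (sym (+𝓡 n)) (ℕ.+-identityʳ n) ⟩
  + 𝓡 n + ∑< n (λ k → F (n ℕ.+ k))
    ≡⟨ cong (_+_ (+ 𝓡 n)) (∑<-cong< n (cong (λ q → ∑< q (χℕ ∘ suc)) ∘ quotient≡1)) ⟩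
  + 𝓡 n + ∑< n (λ _ → 1ℤ)              ≡⟨ cong (_+_ (+ 𝓡 n)) (∑<-one n) ⟩
  + 𝓡 n + + n                          ∎
  where
  open ≡-Reasoning
  F : ℕ → ℤ
  F j = ∑< (2 ℕ.* n ℕ./ suc j) (χℕ ∘ suc)
  2n≡n+n : 2 ℕ.* n ≡ n ℕ.+ n
  2n≡n+n = cong (ℕ._+_ n) (ℕ.+-identityʳ n)
  -- For n < d ≤ 2n the inner sum has length ⌊2n/d⌋ = 1 and so equals χ(1) = 1.
  quotient≡1 : ∀ {k} → k ℕ.< n → 2 ℕ.* n ℕ./ suc (n ℕ.+ k) ≡ 1
  quotient≡1 {k} k<n = trans (m/n≡1+[m∸n]/n le) (cong suc (m<n⇒m/n≡0 lt))
    where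
    le : suc (n ℕ.+ k) ℕ.≤ 2 ℕ.* n
    le = subst (suc (n ℕ.+ k) ℕ.≤_) (sym 2n≡n+n) (ℕ.+-monoʳ-< n k<n)
    lt : 2 ℕ.* n ℕ.∸ suc (n ℕ.+ k) ℕ.< suc (n ℕ.+ k)
    lt = s≤s (ℕ.≤-trans (ℕ.∸-monoʳ-≤ (2 ℕ.* n) (ℕ.m≤n⇒m≤1+n (ℕ.m≤m+n n k)))
      (ℕ.≤-trans (ℕ.≤-reflexive (trans (cong (ℕ._∸ n) 2n≡n+n) (ℕ.m+n∸n≡m n n))) (ℕ.m≤m+n n k)))

-- Cardinality of a decidable subset

lookup-injective : ∀ {xs : List A} → Unique xs → ∀ i j → lookup xs i ≡ lookup xs j → i ≡ j
lookup-injective (_ ∷ _)     Fin.zero    Fin.zero    _  = refl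
lookup-injective (x∉xs ∷ _)  Fin.zero    (Fin.suc j) eq = contradiction eq (All.lookup x∉xs (∈-lookup j))
lookup-injective (x∉xs ∷ _)  (Fin.suc i) Fin.zero    eq = contradiction (sym eq) (All.lookup x∉xs (∈-lookup i))
lookup-injective (_ ∷ xs!)   (Fin.suc i) (Fin.suc j) eq = cong Fin.suc (lookup-injective xs! i j eq)

-- Elements are numbered by their position in the filtered list. Uniqueness makes the position
-- canonical, and irrelevance of `P` makes an element of the Σ-type determined by its first
-- component.
filter-HasCardinality : ∀ {A : Set} {P : A → Set} (P? : Decidable P) → (∀ {x} → Irrelevant (P x)) →
                        ∀ {xs : List A} → Unique xs → (∀ {x} → P x → x ∈ xs) →
                        HasCardinality (Σ A P) (length (filter P? xs))
filter-HasCardinality {A} {P} P? P-irr {xs} xs! P⊆ = mk↔ₛ′ to from to∘from from∘to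
  where
  ys = filter P? xs
  to : Σ A P → Fin (length ys)
  to (x , px) = index (∈-filter⁺ P? (P⊆ px) px)
  from : Fin (length ys) → Σ A P
  from k = lookup ys k , proj₂ (∈-filter⁻ P? {xs = xs} (∈-lookup k))
  to∘from : ∀ k → to (from k) ≡ k
  to∘from k = lookup-injective (Unique.filter⁺ P? xs!) _ k
    (sym (lookup-index (∈-filter⁺ P? (P⊆ (proj₂ (from k))) (proj₂ (from k)))))
  Σ-≡ : ∀ {x y} → x ≡ y → (px : P x) (py : P y) → (x , px) ≡ (y , py)
  Σ-≡ refl px py = cong (_ ,_) (P-irr px py)
  from∘to : ∀ xp → from (to xp) ≡ xp
  from∘to (x , px) = Σ-≡ (sym (lookup-index (∈-filter⁺ P? (P⊆ px) px))) _ px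

-- Solutions in a box

Triple : Set
Triple = ℤ × ℤ × ℤ

weight : Triple → ℤ
weight (i , d , δ) = χ δ * ((δ - + 2 * i) * (d + i))

module Box (M : ℕ) where

  positives : List ℤ
  positives = map +[1+_] (upTo M)

  -- Listed as negatives, zero, positives, so that negation exchanges the outer blocks and even or
  -- odd summands reduce to sums over `positives`.
  interval : List ℤ
  interval = map -_ positives ++ 0ℤ ∷ positives

  ∑-positives : ∀ f → ∑ positives f ≡ ∑< M (f ∘ +[1+_])
  ∑-positives f = trans (∑-map +[1+_] (upTo M) f) (∑-upTo M (f ∘ +[1+_]))

  ∑-interval : ∀ f → ∑ interval f ≡ ∑ positives (f ∘ -_) + (f 0ℤ + ∑ positives f)
  ∑-interval f = trans (∑-++ (map -_ positives) _ f) (cong (_+ (f 0ℤ + ∑ positives f)) (∑-map -_ positives f))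

  ∑-interval-neg : ∀ f → ∑ interval (f ∘ -_) ≡ ∑ interval f
  ∑-interval-neg f = begin
    ∑ interval (f ∘ -_)                                               ≡⟨ ∑-interval (f ∘ -_) ⟩
    ∑ positives (λ z → f (- - z)) + (f 0ℤ + ∑ positives (f ∘ -_))
      ≡⟨ cong (_+ (f 0ℤ + ∑ positives (f ∘ -_))) (∑-cong positives (cong f ∘ neg-involutive)) ⟩
    ∑ positives f + (f 0ℤ + ∑ positives (f ∘ -_))
      ≡⟨ lemma (∑ positives f) (f 0ℤ) (∑ positives (f ∘ -_)) ⟩
    ∑ positives (f ∘ -_) + (f 0ℤ + ∑ positives f)                     ≡⟨ ∑-interval f ⟨
    ∑ interval f                                                      ∎
    where
    open ≡-Reasoning
    lemma : ∀ a b c → a + (b + c) ≡ c + (b + a)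
    lemma = solve-∀

  ∑-interval-odd : ∀ f → (∀ z → f (- z) ≡ - f z) → ∑ interval f ≡ 0ℤ
  ∑-interval-odd f odd = x≡-x⇒x≡0 (begin
    ∑ interval f             ≡⟨ ∑-interval-neg f ⟨
    ∑ interval (f ∘ -_)      ≡⟨ ∑-cong interval odd ⟩
    ∑ interval (λ z → - f z) ≡⟨ ∑-neg interval f ⟩
    - ∑ interval f           ∎)
    where open ≡-Reasoning

  ∈-positives⁺ : ∀ {z} → 0ℤ < z → ∣ z ∣ ℕ.≤ M → z ∈ positives
  ∈-positives⁺ {+ suc k} _ k<M = ∈-map⁺ +[1+_] (∈-upTo⁺ k<M)
  ∈-positives⁺ {+ zero} (+<+ ()) _

  ∈-positives⁻ : ∀ {z} → z ∈ positives → ∃ λ k → k ℕ.< M × z ≡ +[1+ k ]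
  ∈-positives⁻ z∈ with k , k∈ , refl ← ∈-map⁻ +[1+_] z∈ = k , ∈-upTo⁻ k∈ , refl

  ∈-positives⇒>0 : ∀ {z} → z ∈ positives → 0ℤ < z
  ∈-positives⇒>0 z∈ with _ , _ , refl ← ∈-positives⁻ z∈ = +<+ ℕ.z<s

  ∈-interval⁺ : ∀ {z} → ∣ z ∣ ℕ.≤ M → z ∈ interval
  ∈-interval⁺ {+ zero}   _   = ∈-++⁺ʳ (map -_ positives) (here refl)
  ∈-interval⁺ {+[1+ k ]} k<M = ∈-++⁺ʳ (map -_ positives) (there (∈-positives⁺ (+<+ ℕ.z<s) k<M))
  ∈-interval⁺ { -[1+ k ]} k<M = ∈-++⁺ˡ (∈-map⁺ -_ (∈-positives⁺ (+<+ ℕ.z<s) k<M))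

  positives! : Unique positives
  positives! = Unique.map⁺ (ℕ.suc-injective ∘ +-injective) (Unique.upTo⁺ M)

  interval! : Unique interval
  interval! = Unique.++⁺ (Unique.map⁺ neg-injective positives!)
    (All.tabulate (λ z∈ 0≡z → <⇒≢ (∈-positives⇒>0 z∈) 0≡z) ∷ positives!) disjoint
    where
    disjoint : ∀ {z} → ¬ (z ∈ map -_ positives × z ∈ 0ℤ ∷ positives)
    disjoint (z∈- , z∈) with _ , y∈ , refl ← ∈-map⁻ -_ z∈- with _ , _ , refl ← ∈-positives⁻ y∈ with z∈
    ... | there z∈+ with () ← ∈-positives⇒>0 z∈+

  ∑-interval-at-0 : ∀ f → (∀ z → z ≢ 0ℤ → f z ≡ 0ℤ) → ∑ interval f ≡ f 0ℤ
  ∑-interval-at-0 f f≡0 = begin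
    ∑ interval f                                         ≡⟨ ∑-interval f ⟩
    ∑ positives (f ∘ -_) + (f 0ℤ + ∑ positives f)
      ≡⟨ cong₂ (λ a b → a + (f 0ℤ + b)) (vanish (f ∘ -_) λ { +[1+ _ ] _ → f≡0 _ λ () ; (+ zero) (+<+ ()) })
                                        (vanish f λ { +[1+ _ ] _ → f≡0 _ λ () ; (+ zero) (+<+ ()) }) ⟩
    0ℤ + (f 0ℤ + 0ℤ)                                     ≡⟨ trans (+-identityˡ _) (+-identityʳ _) ⟩
    f 0ℤ                                                 ∎
    where
    open ≡-Reasoning
    vanish : ∀ g → (∀ z → 0ℤ < z → g z ≡ 0ℤ) → ∑ positives g ≡ 0ℤ
    vanish g g≡0 = trans (∑-cong∈ positives (g≡0 _ ∘ ∈-positives⇒>0)) (∑-zero positives)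

  triples : List Triple
  triples = cartesianProduct interval (cartesianProduct positives positives)

  triples! : Unique triples
  triples! = Unique.cartesianProduct⁺ interval! (Unique.cartesianProduct⁺ positives! positives!)

  -- Sign-reversing involutions on the solutions of i² + dδ = n

  module _ {n : ℕ} (n≤M : n ℕ.≤ M) where

    -- In the coordinates A = δ − 2i, B = d + i and C = 2d + 2i − δ the equation i² + dδ = n reads
    -- B² + (A² − C²)/4 = n, with d = (A + C)/2 > 0 and δ = 2B − C > 0, and the weight is A B χ(2B − C).
    -- The sign reversals of A, of B and of C preserve the solutions in Above, Below⁻ and Below⁺ respectively.
    Sol Above Below⁻ Below⁺ Fixed : Triple → Set
    Sol (i , d , δ)    = i * i + d * δ ≡ + n × 0ℤ < d × 0ℤ < δ
    Above  x@(i , d , δ) = Sol x × δ - + 2 * i < d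
    Below⁻ x@(i , d , δ) = Sol x × d < δ - + 2 * i × + 4 * (d + i) < δ
    Below⁺ x@(i , d , δ) = Sol x × d < δ - + 2 * i × δ < + 4 * (d + i)
    Fixed  x@(i , d , δ) = Sol x × d ≡ δ - + 2 * i

    Sol? : Decidable Sol
    Sol? (i , d , δ) = (i * i + d * δ ≟ + n) ×-dec (0ℤ <? d) ×-dec (0ℤ <? δ)
    Above? : Decidable Above
    Above? x@(i , d , δ) = Sol? x ×-dec (δ - + 2 * i <? d)
    Below⁻? : Decidable Below⁻
    Below⁻? x@(i , d , δ) = Sol? x ×-dec (d <? δ - + 2 * i) ×-dec (+ 4 * (d + i) <? δ)
    Below⁺? : Decidable Below⁺
    Below⁺? x@(i , d , δ) = Sol? x ×-dec (d <? δ - + 2 * i) ×-dec (δ <? + 4 * (d + i))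
    Fixed? : Decidable Fixed
    Fixed? x@(i , d , δ) = Sol? x ×-dec (d ≟ δ - + 2 * i)

    -- Each of |i|, d and δ is at most i² + dδ = n, because |i| ≤ i² and d, δ ≥ 1.
    Sol⇒∈ : ∀ {x} → Sol x → x ∈ triples
    Sol⇒∈ {i , +[1+ d ] , +[1+ δ ]} (eq , _ , _) =
      ∈-cartesianProduct⁺
        (∈-interval⁺ (≤M (ℕ.≤-trans (k≤k*k ∣ i ∣) (ℕ.m≤m+n _ _))))
        (∈-cartesianProduct⁺
          (∈-positives⁺ (+<+ ℕ.z<s) (≤M (ℕ.≤-trans (ℕ.m≤m*n (suc d) (suc δ)) (ℕ.m≤n+m _ (∣ i ∣ ℕ.* ∣ i ∣)))))
          (∈-positives⁺ (+<+ ℕ.z<s) (≤M (ℕ.≤-trans (ℕ.m≤n*m (suc δ) (suc d)) (ℕ.m≤n+m _ (∣ i ∣ ℕ.* ∣ i ∣))))))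
      where
      eqℕ : ∣ i ∣ ℕ.* ∣ i ∣ ℕ.+ suc d ℕ.* suc δ ≡ n
      eqℕ = +-injective (trans (cong (_+ + (suc d ℕ.* suc δ)) (sym (square i))) eq)
      ≤M : ∀ {k} → k ℕ.≤ ∣ i ∣ ℕ.* ∣ i ∣ ℕ.+ suc d ℕ.* suc δ → k ℕ.≤ M
      ≤M k≤ = ℕ.≤-trans k≤ (ℕ.≤-trans (ℕ.≤-reflexive eqℕ) n≤M)
    Sol⇒∈ {_ , + zero , _} (_ , +<+ () , _)
    Sol⇒∈ {_ , +[1+ _ ] , + zero} (_ , _ , +<+ ())

    -- Reversing A turns d = (A + C)/2 into (C - A)/2 = d - A and fixes δ. `Above` is the condition
    -- that the new d is positive; for the image this condition becomes positivity of the old d.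
    ∑-Above : ∑ triples (λ x → 𝟙 (Above? x) * weight x) ≡ 0ℤ
    ∑-Above = ∑-involution triples! Above? (Sol⇒∈ ∘ proj₁) σ σσ Pσ weight negates
      where
      σ : Triple → Triple
      σ (i , d , δ) = δ - i , d - (δ - + 2 * i) , δ
      σσ : ∀ x → σ (σ x) ≡ x
      σσ (i , d , δ) = cong₂ (λ a b → a , b , δ) (e₁ i δ) (e₂ i d δ)
        where
        e₁ : ∀ i δ → δ - (δ - i) ≡ i
        e₁ = solve-∀
        e₂ : ∀ i d δ → d - (δ - + 2 * i) - (δ - + 2 * (δ - i)) ≡ d
        e₂ = solve-∀
      Pσ : ∀ {x} → Above x → Above (σ x)
      Pσ {i , d , δ} ((eq , 0<d , 0<δ) , A<d) =
        (trans (e₁ i d δ) eq , i<j⇒0<j-i A<d , 0<δ) , 0<j-i⇒i<j (pos-subst (e₂ i d δ) 0<d)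
        where
        e₁ : ∀ i d δ → (δ - i) * (δ - i) + (d - (δ - + 2 * i)) * δ ≡ i * i + d * δ
        e₁ = solve-∀
        e₂ : ∀ i d δ → d ≡ d - (δ - + 2 * i) - (δ - + 2 * (δ - i))
        e₂ = solve-∀
      negates : ∀ {x} → Above x → weight (σ x) ≡ - weight x
      negates {i , d , δ} _ = e (χ δ) i d δ
        where
        e : ∀ c i d δ → c * ((δ - + 2 * (δ - i)) * (d - (δ - + 2 * i) + (δ - i)))
                      ≡ - (c * ((δ - + 2 * i) * (d + i)))
        e = solve-∀

    -- Reversing B fixes d and A and turns δ = 2B - C into δ - 4B, which the last condition of
    -- `Below⁻` makes positive. By periodicity χ keeps its value, so only the factor B changes sign.
    ∑-Below⁻ : ∑ triples (λ x → 𝟙 (Below⁻? x) * weight x) ≡ 0ℤ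
    ∑-Below⁻ = ∑-involution triples! Below⁻? (Sol⇒∈ ∘ proj₁) σ σσ Pσ weight negates
      where
      σ : Triple → Triple
      σ (i , d , δ) = - i - + 2 * d , d , δ - + 4 * (d + i)
      σσ : ∀ x → σ (σ x) ≡ x
      σσ (i , d , δ) = cong₂ (λ a b → a , d , b) (e₁ i d) (e₂ i d δ)
        where
        e₁ : ∀ i d → - (- i - + 2 * d) - + 2 * d ≡ i
        e₁ = solve-∀
        e₂ : ∀ i d δ → δ - + 4 * (d + i) - + 4 * (d + (- i - + 2 * d)) ≡ δ
        e₂ = solve-∀
      Pσ : ∀ {x} → Below⁻ x → Below⁻ (σ x)
      Pσ {i , d , δ} ((eq , 0<d , 0<δ) , d<A , 4B<δ) =
        (trans (e₁ i d δ) eq , 0<d , i<j⇒0<j-i 4B<δ) ,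
        subst (d <_) (e₂ i d δ) d<A ,
        0<j-i⇒i<j (pos-subst (e₃ i d δ) 0<δ)
        where
        e₁ : ∀ i d δ → (- i - + 2 * d) * (- i - + 2 * d) + d * (δ - + 4 * (d + i)) ≡ i * i + d * δ
        e₁ = solve-∀
        e₂ : ∀ i d δ → δ - + 2 * i ≡ δ - + 4 * (d + i) - + 2 * (- i - + 2 * d)
        e₂ = solve-∀
        e₃ : ∀ i d δ → δ ≡ δ - + 4 * (d + i) - + 4 * (d + (- i - + 2 * d))
        e₃ = solve-∀
      negates : ∀ {x} → Below⁻ x → weight (σ x) ≡ - weight x
      negates {i , d , δ} _ =
        trans (cong (_* ((δ - + 4 * (d + i) - + 2 * (- i - + 2 * d)) * (d + (- i - + 2 * d)))) (χ-periodic δ (d + i)))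
              (e (χ δ) i d δ)
        where
        e : ∀ c i d δ → c * ((δ - + 4 * (d + i) - + 2 * (- i - + 2 * d)) * (d + (- i - + 2 * d)))
                      ≡ - (c * ((δ - + 2 * i) * (d + i)))
        e = solve-∀

    -- Reversing C turns d into A - d and δ into 4B - δ, and the two inequalities of `Below⁺` say
    -- that these are positive. The factors A and B stay; the sign comes from χ(4B - δ) = -χ(δ).
    ∑-Below⁺ : ∑ triples (λ x → 𝟙 (Below⁺? x) * weight x) ≡ 0ℤ
    ∑-Below⁺ = ∑-involution triples! Below⁺? (Sol⇒∈ ∘ proj₁) σ σσ Pσ weight negates
      where
      σ : Triple → Triple
      σ (i , d , δ) = + 2 * d + + 3 * i - δ , δ - + 2 * i - d , + 4 * (d + i) - δ
      σσ : ∀ x → σ (σ x) ≡ x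
      σσ (i , d , δ) = cong₂ _,_ (e₁ i d δ) (cong₂ _,_ (e₂ i d δ) (e₃ i d δ))
        where
        e₁ : ∀ i d δ → + 2 * (δ - + 2 * i - d) + + 3 * (+ 2 * d + + 3 * i - δ) - (+ 4 * (d + i) - δ) ≡ i
        e₁ = solve-∀
        e₂ : ∀ i d δ → + 4 * (d + i) - δ - + 2 * (+ 2 * d + + 3 * i - δ) - (δ - + 2 * i - d) ≡ d
        e₂ = solve-∀
        e₃ : ∀ i d δ → + 4 * (δ - + 2 * i - d + (+ 2 * d + + 3 * i - δ)) - (+ 4 * (d + i) - δ) ≡ δ
        e₃ = solve-∀
      Pσ : ∀ {x} → Below⁺ x → Below⁺ (σ x)
      Pσ {i , d , δ} ((eq , 0<d , 0<δ) , d<A , δ<4B) =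
        (trans (e₁ i d δ) eq , i<j⇒0<j-i d<A , i<j⇒0<j-i δ<4B) ,
        0<j-i⇒i<j (pos-subst (e₂ i d δ) 0<d) ,
        0<j-i⇒i<j (pos-subst (e₃ i d δ) 0<δ)
        where
        e₁ : ∀ i d δ → (+ 2 * d + + 3 * i - δ) * (+ 2 * d + + 3 * i - δ)
                       + (δ - + 2 * i - d) * (+ 4 * (d + i) - δ) ≡ i * i + d * δ
        e₁ = solve-∀
        e₂ : ∀ i d δ → d ≡ + 4 * (d + i) - δ - + 2 * (+ 2 * d + + 3 * i - δ) - (δ - + 2 * i - d)
        e₂ = solve-∀
        e₃ : ∀ i d δ → δ ≡ + 4 * (δ - + 2 * i - d + (+ 2 * d + + 3 * i - δ)) - (+ 4 * (d + i) - δ)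
        e₃ = solve-∀
      negates : ∀ {x} → Below⁺ x → weight (σ x) ≡ - weight x
      negates {i , d , δ} _ =
        trans (cong (_* ((+ 4 * (d + i) - δ - + 2 * (+ 2 * d + + 3 * i - δ))
                         * (δ - + 2 * i - d + (+ 2 * d + + 3 * i - δ)))) χ-flip)
              (e (χ δ) i d δ)
        where
        flip : ∀ b δ → + 4 * b - δ ≡ - (δ - + 4 * b)
        flip = solve-∀
        χ-flip : χ (+ 4 * (d + i) - δ) ≡ - χ δ
        χ-flip = trans (cong χ (flip (d + i) δ))
                 (trans (χ-neg (δ - + 4 * (d + i))) (cong -_ (χ-periodic δ (d + i))))
        e : ∀ c i d δ → - c * ((+ 4 * (d + i) - δ - + 2 * (+ 2 * d + + 3 * i - δ))
                                * (δ - + 2 * i - d + (+ 2 * d + + 3 * i - δ)))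
                      ≡ - (c * ((δ - + 2 * i) * (d + i)))
        e = solve-∀

    -- The inequality is d > 0 for d = 2s - δ. Positivity of s and δ is left to membership in
    -- `positives`.
    Root : ℤ × ℤ → Set
    Root (s , δ) = s * s ≡ + n × δ < + 2 * s
    Root? : Decidable Root
    Root? (s , δ) = (s * s ≟ + n) ×-dec (δ <? + 2 * s)

    -- With s = d + i, a solution in Fixed satisfies s² = n, and d = 2s − δ.
    ∑-Fixed : ∑ triples (λ x → 𝟙 (Fixed? x) * weight x) ≡
              ∑ (cartesianProduct positives positives)
                (λ y → 𝟙 (Root? y) * (χ (proj₂ y) * ((+ 2 * proj₁ y - proj₂ y) * proj₁ y)))
    ∑-Fixed = begin
      ∑ triples (λ x → 𝟙 (Fixed? x) * weight x)  ≡⟨ ∑-filter Fixed? triples weight ⟨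
      ∑ (filter Fixed? triples) weight           ≡⟨ ∑-cong∈ (filter Fixed? triples) (weight-φ ∘ Fixed-of) ⟩
      ∑ (filter Fixed? triples) (g ∘ φ)
        ≡⟨ ∑-bijection (Unique.filter⁺ Fixed? triples!)
             (Unique.filter⁺ Root? (Unique.cartesianProduct⁺ positives! positives!))
             φ ψ (λ x∈ → φ∈ (Fixed-of x∈)) (λ y∈ → ψ∈ (Root-of y∈)) (λ x∈ → ψφ (Fixed-of x∈)) (λ {y} _ → φψ y) g ⟩
      ∑ (filter Root? pairs) g                   ≡⟨ ∑-filter Root? pairs g ⟩
      ∑ pairs (λ y → 𝟙 (Root? y) * g y)          ∎
      where
      open ≡-Reasoning
      pairs = cartesianProduct positives positives
      g : ℤ × ℤ → ℤ
      g (s , δ) = χ δ * ((+ 2 * s - δ) * s)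
      φ : Triple → ℤ × ℤ
      φ (i , d , δ) = d + i , δ
      ψ : ℤ × ℤ → Triple
      ψ (s , δ) = δ - s , + 2 * s - δ , δ
      Fixed-of : ∀ {x} → x ∈ filter Fixed? triples → Fixed x
      Fixed-of x∈ = proj₂ (∈-filter⁻ Fixed? {xs = triples} x∈)
      Root-of : ∀ {y} → y ∈ filter Root? pairs → (0ℤ < proj₂ y) × Root y
      Root-of {y} y∈ = let y∈pairs , r = ∈-filter⁻ Root? {xs = pairs} y∈
                   in ∈-positives⇒>0 (proj₂ (∈-cartesianProduct⁻ positives positives y∈pairs)) , r
      weight-φ : ∀ {x} → Fixed x → weight x ≡ g (φ x)
      weight-φ {i , d , δ} (_ , refl) = e (χ δ) i δ
        where
        e : ∀ c i δ → c * ((δ - + 2 * i) * (δ - + 2 * i + i))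
                      ≡ c * ((+ 2 * (δ - + 2 * i + i) - δ) * (δ - + 2 * i + i))
        e = solve-∀
      φ∈ : ∀ {x} → Fixed x → φ x ∈ filter Root? pairs
      φ∈ {i , d , δ} (sol@(eq , 0<d , 0<δ) , refl) =
        ∈-filter⁺ Root? (∈-cartesianProduct⁺ (∈-positives⁺ 0<s s≤M) δ∈) (s²≡n , 0<j-i⇒i<j (pos-subst (e₂ i δ) 0<d))
        where
        e₁ : ∀ i δ → (δ - + 2 * i + i) * (δ - + 2 * i + i) ≡ i * i + (δ - + 2 * i) * δ
        e₁ = solve-∀
        e₂ : ∀ i δ → δ - + 2 * i ≡ + 2 * (δ - + 2 * i + i) - δ
        e₂ = solve-∀
        e₃ : ∀ i δ → δ - + 2 * i + δ ≡ (δ - + 2 * i + i) + (δ - + 2 * i + i)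
        e₃ = solve-∀
        s = δ - + 2 * i + i
        s²≡n : s * s ≡ + n
        s²≡n = trans (e₁ i δ) eq
        0<s : 0ℤ < s
        -- From s = d + i and d = δ - 2i one gets 2s = d + δ.
        0<s = 0<i+i⇒0<i (pos-subst (e₃ i δ) (+-mono-< 0<d 0<δ))
        s≤M : ∣ s ∣ ℕ.≤ M
        s≤M = ℕ.≤-trans (k≤k*k ∣ s ∣) (ℕ.≤-trans (ℕ.≤-reflexive (+-injective (trans (sym (square s)) s²≡n))) n≤M)
        δ∈ : δ ∈ positives
        δ∈ = proj₂ (∈-cartesianProduct⁻ positives positives (proj₂ (∈-cartesianProduct⁻ interval pairs (Sol⇒∈ {i , d , δ} sol))))
      ψ∈ : ∀ {y} → (0ℤ < proj₂ y) × Root y → ψ y ∈ filter Fixed? triples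
      ψ∈ {s , δ} (0<δ , s²≡n , δ<2s) = ∈-filter⁺ Fixed? (Sol⇒∈ sol) (sol , e₂ s δ)
        where
        e₁ : ∀ s δ → (δ - s) * (δ - s) + (+ 2 * s - δ) * δ ≡ s * s
        e₁ = solve-∀
        e₂ : ∀ s δ → + 2 * s - δ ≡ δ - + 2 * (δ - s)
        e₂ = solve-∀
        sol : Sol (ψ (s , δ))
        sol = trans (e₁ s δ) s²≡n , i<j⇒0<j-i δ<2s , 0<δ
      ψφ : ∀ {x} → Fixed x → ψ (φ x) ≡ x
      ψφ {i , d , δ} (_ , refl) = cong₂ (λ a b → a , b , δ) (e₁ i δ) (e₂ i δ)
        where
        e₁ : ∀ i δ → δ - (δ - + 2 * i + i) ≡ i
        e₁ = solve-∀
        e₂ : ∀ i δ → + 2 * (δ - + 2 * i + i) - δ ≡ δ - + 2 * i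
        e₂ = solve-∀
      φψ : ∀ y → φ (ψ y) ≡ y
      φψ (s , δ) = cong (_, δ) (e s δ)
        where
        e : ∀ s δ → + 2 * s - δ + (δ - s) ≡ s
        e = solve-∀

    -- The sum is s times the weighted character sum `∑χ-weighted`, whose value is s again, and s² =
    -- n.
    ∑-below-twice : ∀ {s} → 0ℤ < s → s * s ≡ + n →
                    ∑ positives (λ δ → 𝟙 (δ <? + 2 * s) * (χ δ * ((+ 2 * s - δ) * s))) ≡ + n
    ∑-below-twice {+ zero} (+<+ ()) _
    ∑-below-twice {s@(+[1+ t ])} _ s²≡n = begin
      ∑ positives (λ δ → 𝟙 (δ <? + 2 * s) * (χ δ * ((+ 2 * s - δ) * s)))
        ≡⟨ ∑-cong positives (λ δ → regroup (𝟙 (δ <? + 2 * s)) (χ δ) (+ 2 * s - δ) s) ⟩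
      ∑ positives (λ δ → s * (𝟙 (δ <? + 2 * s) * (χ δ * (+ 2 * s - δ))))
        ≡⟨ *-distribˡ-∑ s positives (λ δ → 𝟙 (δ <? + 2 * s) * (χ δ * (+ 2 * s - δ))) ⟨
      s * ∑ positives (λ δ → 𝟙 (δ <? + 2 * s) * (χ δ * (+ 2 * s - δ)))
        ≡⟨ cong (s *_) (∑-positives _) ⟩
      s * ∑< M (λ k → 𝟙 (+[1+ k ] <? + 2 * s) * (χℕ (suc k) * (+ 2 * s - +[1+ k ])))
        ≡⟨ cong (s *_) (∑<-cong M λ k → cong₂ _*_
             (𝟙-cong (+[1+ k ] <? + 2 * s) (k ℕ.<? q) (<⇒ k) (<⇐ k))
             (cong (χℕ (suc k) *_) (shift (+ t) (+ k)))) ⟩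
      s * ∑< M (λ k → 𝟙 (k ℕ.<? q) * (χℕ (suc k) * (+ q - + k)))
        ≡⟨ cong (s *_) (∑<-truncate q≤M (λ k → χℕ (suc k) * (+ q - + k))) ⟩
      s * ∑< q (λ k → χℕ (suc k) * (+ q - + k))   ≡⟨ cong (s *_) (∑χ-weighted t) ⟩
      s * s                                       ≡⟨ s²≡n ⟩
      + n                                         ∎
      where
      open ≡-Reasoning
      q = suc (t ℕ.+ t)
      regroup : ∀ a b c d → a * (b * (c * d)) ≡ d * (a * (b * c))
      regroup = solve-∀
      shift : ∀ t k → + 2 * (1ℤ + t) - (1ℤ + k) ≡ 1ℤ + (t + t) - k
      shift = solve-∀
      2s≡ : ∀ t → + 2 * (1ℤ + t) ≡ 1ℤ + (1ℤ + (t + t))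
      2s≡ = solve-∀
      <⇒ : ∀ k → +[1+ k ] < + 2 * s → k ℕ.< q
      <⇒ k lt = ℕ.s<s⁻¹ (drop‿+<+ (subst (+[1+ k ] <_) (2s≡ (+ t)) lt))
      <⇐ : ∀ k → k ℕ.< q → +[1+ k ] < + 2 * s
      <⇐ k lt = subst (+[1+ k ] <_) (sym (2s≡ (+ t))) (+<+ (ℕ.s<s lt))
      -- The box contains every δ < 2s, since 2s - 1 ≤ s² = n ≤ M.
      q≤s² : ∀ t → suc (t ℕ.+ t) ℕ.≤ suc t ℕ.* suc t
      q≤s² t = s≤s (ℕ.+-monoʳ-≤ t (ℕ.m≤m*n t (suc t)))
      q≤M : q ℕ.≤ M
      q≤M = ℕ.≤-trans (q≤s² t) (ℕ.≤-trans (ℕ.≤-reflexive (+-injective s²≡n)) n≤M)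

    -- Whether n is a square is never decided. The indicator sum over s is carried along and cancels
    -- against the same sum in `δ₀-recurrence`.
    ∑-Root : ∑ (cartesianProduct positives positives)
               (λ y → 𝟙 (Root? y) * (χ (proj₂ y) * ((+ 2 * proj₁ y - proj₂ y) * proj₁ y)))
             ≡ + n * ∑ positives (λ s → 𝟙 (s * s ≟ + n))
    ∑-Root = begin
      ∑ (cartesianProduct positives positives) (λ y → 𝟙 (Root? y) * g y)
        ≡⟨ ∑-cartesianProduct positives positives (λ y → 𝟙 (Root? y) * g y) ⟩
      ∑ positives (λ s → ∑ positives (λ δ → 𝟙 (Root? (s , δ)) * g (s , δ)))
        ≡⟨ ∑-cong∈ positives (λ {s} s∈ → row s (∈-positives⇒>0 s∈)) ⟩
      ∑ positives (λ s → + n * 𝟙 (s * s ≟ + n))    ≡⟨ *-distribˡ-∑ (+ n) positives _ ⟨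
      + n * ∑ positives (λ s → 𝟙 (s * s ≟ + n))    ∎
      where
      open ≡-Reasoning
      g : ℤ × ℤ → ℤ
      g (s , δ) = χ δ * ((+ 2 * s - δ) * s)
      row : ∀ s → 0ℤ < s → ∑ positives (λ δ → 𝟙 (Root? (s , δ)) * g (s , δ)) ≡ + n * 𝟙 (s * s ≟ + n)
      row s 0<s = begin
        ∑ positives (λ δ → 𝟙 (Root? (s , δ)) * g (s , δ))
          ≡⟨ ∑-cong positives (λ δ → trans
               (cong (_* g (s , δ)) (𝟙-× (s * s ≟ + n) (δ <? + 2 * s)))
               (*-assoc (𝟙 (s * s ≟ + n)) (𝟙 (δ <? + 2 * s)) (g (s , δ)))) ⟩
        ∑ positives (λ δ → 𝟙 (s * s ≟ + n) * (𝟙 (δ <? + 2 * s) * g (s , δ)))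
          ≡⟨ *-distribˡ-∑ (𝟙 (s * s ≟ + n)) positives (λ δ → 𝟙 (δ <? + 2 * s) * g (s , δ)) ⟨
        𝟙 (s * s ≟ + n) * ∑ positives (λ δ → 𝟙 (δ <? + 2 * s) * g (s , δ))
          ≡⟨ 𝟙*-cong (s * s ≟ + n) (∑-below-twice 0<s) ⟩
        𝟙 (s * s ≟ + n) * + n                    ≡⟨ *-comm (𝟙 (s * s ≟ + n)) (+ n) ⟩
        + n * 𝟙 (s * s ≟ + n)                    ∎

    -- The case 4(d + i) = δ is missing on the right, but there χ δ = 0.
    𝟙-Sol-split : ∀ x → 𝟙 (Sol? x) * weight x ≡
                  𝟙 (Above? x) * weight x + (𝟙 (Below⁻? x) * weight x +
                  (𝟙 (Below⁺? x) * weight x + 𝟙 (Fixed? x) * weight x))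
    𝟙-Sol-split x@(i , d , δ) = cases (Sol? x)
      where
      w = weight x
      r = δ - + 2 * i
      -- Each case supplies the values 0 or 1 of the five indicators, which leaves an equation in
      -- `w` with these constants.
      combine : ∀ {s s′ a a′ b b′ c c′ f f′} → s ≡ s′ → a ≡ a′ → b ≡ b′ → c ≡ c′ → f ≡ f′ →
                s′ * w ≡ a′ * w + (b′ * w + (c′ * w + f′ * w)) → s * w ≡ a * w + (b * w + (c * w + f * w))
      combine refl refl refl refl refl eq = eq
      none : ∀ w → 0ℤ * w ≡ 0ℤ * w + (0ℤ * w + (0ℤ * w + 0ℤ * w))
      none = solve-∀
      first : ∀ w → 1ℤ * w ≡ 1ℤ * w + (0ℤ * w + (0ℤ * w + 0ℤ * w))
      first = solve-∀
      second : ∀ w → 1ℤ * w ≡ 0ℤ * w + (1ℤ * w + (0ℤ * w + 0ℤ * w))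
      second = solve-∀
      third : ∀ w → 1ℤ * w ≡ 0ℤ * w + (0ℤ * w + (1ℤ * w + 0ℤ * w))
      third = solve-∀
      fourth : ∀ w → 1ℤ * w ≡ 0ℤ * w + (0ℤ * w + (0ℤ * w + 1ℤ * w))
      fourth = solve-∀
      χ-4*≡0 : ∀ b → δ ≡ + 4 * b → χ δ ≡ 0ℤ
      χ-4*≡0 b refl = trans (sym (χ-periodic (+ 4 * b) b)) (cong χ (+-inverseʳ (+ 4 * b)))
      w≡0 : + 4 * (d + i) ≡ δ → w ≡ 0ℤ
      w≡0 eq = trans (cong (_* (r * (d + i))) (χ-4*≡0 (d + i) (sym eq))) (*-zeroˡ (r * (d + i)))
      vanish : w ≡ 0ℤ → 1ℤ * w ≡ 0ℤ * w + (0ℤ * w + (0ℤ * w + 0ℤ * w))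
      vanish eq = trans (trans (*-identityˡ w) (trans eq (sym (*-zeroˡ w)))) (none w)
      below : Sol x → d < r → Dec (+ 4 * (d + i) < δ) → Dec (δ < + 4 * (d + i)) →
              𝟙 (Sol? x) * w ≡ 𝟙 (Above? x) * w + (𝟙 (Below⁻? x) * w +
              (𝟙 (Below⁺? x) * w + 𝟙 (Fixed? x) * w))
      below sol d<r (yes lt) (yes gt) = contradiction (<-trans lt gt) (<-irrefl refl)
      below sol d<r (yes lt) (no ≯) =
        combine (𝟙-yes (Sol? x) sol) (𝟙-no (Above? x) (<-asym d<r ∘ proj₂))
          (𝟙-yes (Below⁻? x) (sol , d<r , lt)) (𝟙-no (Below⁺? x) (≯ ∘ proj₂ ∘ proj₂))
          (𝟙-no (Fixed? x) (<⇒≢ d<r ∘ proj₂)) (second w)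
      below sol d<r (no ≮) (yes gt) =
        combine (𝟙-yes (Sol? x) sol) (𝟙-no (Above? x) (<-asym d<r ∘ proj₂))
          (𝟙-no (Below⁻? x) (≮ ∘ proj₂ ∘ proj₂)) (𝟙-yes (Below⁺? x) (sol , d<r , gt))
          (𝟙-no (Fixed? x) (<⇒≢ d<r ∘ proj₂)) (third w)
      below sol d<r (no ≮) (no ≯) =
        combine (𝟙-yes (Sol? x) sol) (𝟙-no (Above? x) (<-asym d<r ∘ proj₂))
          (𝟙-no (Below⁻? x) (≮ ∘ proj₂ ∘ proj₂)) (𝟙-no (Below⁺? x) (≯ ∘ proj₂ ∘ proj₂))
          (𝟙-no (Fixed? x) (<⇒≢ d<r ∘ proj₂)) (vanish (w≡0 (≤-antisym (≮⇒≥ ≯) (≮⇒≥ ≮))))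
      cases : Dec (Sol x) →
              𝟙 (Sol? x) * w ≡ 𝟙 (Above? x) * w + (𝟙 (Below⁻? x) * w +
              (𝟙 (Below⁺? x) * w + 𝟙 (Fixed? x) * w))
      cases (no ¬sol) =
        combine (𝟙-no (Sol? x) ¬sol) (𝟙-no (Above? x) (¬sol ∘ proj₁))
          (𝟙-no (Below⁻? x) (¬sol ∘ proj₁)) (𝟙-no (Below⁺? x) (¬sol ∘ proj₁))
          (𝟙-no (Fixed? x) (¬sol ∘ proj₁)) (none w)
      cases (yes sol) with <-cmp d r
      ... | tri< d<r _ _ = below sol d<r (+ 4 * (d + i) <? δ) (δ <? + 4 * (d + i))
      ... | tri≈ _ d≡r _ =
        combine (𝟙-yes (Sol? x) sol) (𝟙-no (Above? x) (<-irrefl (sym d≡r) ∘ proj₂))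
          (𝟙-no (Below⁻? x) (<-irrefl d≡r ∘ proj₁ ∘ proj₂)) (𝟙-no (Below⁺? x) (<-irrefl d≡r ∘ proj₁ ∘ proj₂))
          (𝟙-yes (Fixed? x) (sol , d≡r)) (fourth w)
      ... | tri> _ _ r<d =
        combine (𝟙-yes (Sol? x) sol) (𝟙-yes (Above? x) (sol , r<d))
          (𝟙-no (Below⁻? x) (<-asym r<d ∘ proj₁ ∘ proj₂)) (𝟙-no (Below⁺? x) (<-asym r<d ∘ proj₁ ∘ proj₂))
          (𝟙-no (Fixed? x) (<⇒≢ r<d ∘ sym ∘ proj₂)) (first w)

    ∑-Sol : ∑ triples (λ x → 𝟙 (Sol? x) * weight x) ≡ + n * ∑ positives (λ s → 𝟙 (s * s ≟ + n))
    ∑-Sol = begin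
      ∑ triples (λ x → 𝟙 (Sol? x) * weight x)  ≡⟨ ∑-cong triples 𝟙-Sol-split ⟩
      ∑ triples (λ x → a x + (b x + (c x + f x)))
        ≡⟨ ∑-distrib-+ triples a (λ x → b x + (c x + f x)) ⟩
      ∑ triples a + ∑ triples (λ x → b x + (c x + f x))
        ≡⟨ cong (_+_ (∑ triples a)) (∑-distrib-+ triples b (λ x → c x + f x)) ⟩
      ∑ triples a + (∑ triples b + ∑ triples (λ x → c x + f x))
        ≡⟨ cong (λ t → ∑ triples a + (∑ triples b + t)) (∑-distrib-+ triples c f) ⟩
      ∑ triples a + (∑ triples b + (∑ triples c + ∑ triples f))
        ≡⟨ cong₂ _+_ ∑-Above (cong₂ _+_ ∑-Below⁻ (cong₂ _+_ ∑-Below⁺ (trans ∑-Fixed ∑-Root))) ⟩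
      0ℤ + (0ℤ + (0ℤ + R))                          ≡⟨ lemma R ⟩
      R                                             ∎
      where
      open ≡-Reasoning
      a b c f : Triple → ℤ
      a x = 𝟙 (Above? x) * weight x
      b x = 𝟙 (Below⁻? x) * weight x
      c x = 𝟙 (Below⁺? x) * weight x
      f x = 𝟙 (Fixed? x) * weight x
      R = + n * ∑ positives (λ s → 𝟙 (s * s ≟ + n))
      lemma : ∀ r → 0ℤ + (0ℤ + (0ℤ + r)) ≡ r
      lemma = solve-∀

  -- Jacobi's formula

  -- Here and in `ρ` the variables are confined to the box, so the full sums are obtained for m ≤ M.
  -- The argument is an integer because n - i² may be negative in the recurrence.
  r₂ : ℤ → ℤ
  r₂ m = ∑ interval (λ a → ∑ interval (λ b → 𝟙 (a * a + b * b ≟ m)))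

  ρ : ℤ → ℤ
  ρ m = ∑ positives (λ d → ∑ positives (λ δ → 𝟙 (d * δ ≟ m) * χ δ))

  -- The sum over i² + j² + k² = n of n − 3i² = (j² − i²) + (k² − i²) vanishes by symmetry.
  r₂-recurrence : ∀ n → ∑ interval (λ i → (n - + 3 * (i * i)) * r₂ (n - i * i)) ≡ 0ℤ
  r₂-recurrence n = begin
    ∑ interval (λ i → (n - + 3 * (i * i)) * r₂ (n - i * i))
      ≡⟨ ∑-cong interval expand ⟩
    ∑ interval (λ i → ∑ interval (λ j → ∑ interval (t i j)) + ∑ interval (λ j → ∑ interval (t i j)))
      ≡⟨ ∑-distrib-+ interval (λ i → ∑ interval (λ j → ∑ interval (t i j))) _ ⟩
    U + U
      ≡⟨ cong₂ _+_ U≡0 U≡0 ⟩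
    0ℤ ∎
    where
    open ≡-Reasoning
    eq? : ∀ i j k → Dec (i * i + (j * j + k * k) ≡ n)
    eq? i j k = i * i + (j * j + k * k) ≟ n
    t : ℤ → ℤ → ℤ → ℤ
    t i j k = 𝟙 (eq? i j k) * (j * j - i * i)
    U = ∑ interval (λ i → ∑ interval (λ j → ∑ interval (t i j)))
    U≡0 : U ≡ 0ℤ
    U≡0 = ∑-antisym interval (λ i j → ∑ interval (t i j)) λ i j →
      trans (∑-cong interval (anti i j)) (∑-neg interval (t j i))
      where
      perm : ∀ i j k → i * i + (j * j + k * k) ≡ j * j + (i * i + k * k)
      perm = solve-∀
      flip : ∀ c x y → c * (x - y) ≡ - (c * (y - x))
      flip = solve-∀
      anti : ∀ i j k → t i j k ≡ - t j i k
      anti i j k = trans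
        (cong (_* (j * j - i * i)) (𝟙-cong (eq? i j k) (eq? j i k) (trans (perm j i k)) (trans (perm i j k))))
        (flip (𝟙 (eq? j i k)) (j * j) (i * i))
    term : ∀ i j k → (n - + 3 * (i * i)) * 𝟙 (j * j + k * k ≟ n - i * i) ≡ t i j k + t i k j
    term i j k = begin
      (n - + 3 * (i * i)) * 𝟙 (j * j + k * k ≟ n - i * i)
        ≡⟨ *-comm (n - + 3 * (i * i)) _ ⟩
      𝟙 (j * j + k * k ≟ n - i * i) * (n - + 3 * (i * i))
        ≡⟨ cong (_* (n - + 3 * (i * i))) (𝟙-cong (j * j + k * k ≟ n - i * i) (eq? i j k) y≡z-x⇒x+y≡z x+y≡z⇒y≡z-x) ⟩
      𝟙 (eq? i j k) * (n - + 3 * (i * i))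
        ≡⟨ 𝟙*-cong (eq? i j k) (λ eq → trans (cong (_- + 3 * (i * i)) (sym eq)) (poly i j k)) ⟩
      𝟙 (eq? i j k) * ((j * j - i * i) + (k * k - i * i))
        ≡⟨ *-distribˡ-+ (𝟙 (eq? i j k)) (j * j - i * i) (k * k - i * i) ⟩
      t i j k + 𝟙 (eq? i j k) * (k * k - i * i)
        ≡⟨ cong (λ c → t i j k + c * (k * k - i * i))
             (𝟙-cong (eq? i j k) (eq? i k j) (trans (perm i k j)) (trans (perm i j k))) ⟩
      t i j k + t i k j ∎
      where
      poly : ∀ i j k → i * i + (j * j + k * k) - + 3 * (i * i) ≡ (j * j - i * i) + (k * k - i * i)
      poly = solve-∀
      perm : ∀ i j k → i * i + (j * j + k * k) ≡ i * i + (k * k + j * j)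
      perm = solve-∀
    expand : ∀ i → (n - + 3 * (i * i)) * r₂ (n - i * i) ≡
                   ∑ interval (λ j → ∑ interval (t i j)) + ∑ interval (λ j → ∑ interval (t i j))
    expand i = begin
      c * r₂ (n - i * i)
        ≡⟨ *-distribˡ-∑ c interval _ ⟩
      ∑ interval (λ j → c * ∑ interval (λ k → 𝟙 (j * j + k * k ≟ n - i * i)))
        ≡⟨ ∑-cong interval (λ j → *-distribˡ-∑ c interval _) ⟩
      ∑ interval (λ j → ∑ interval (λ k → c * 𝟙 (j * j + k * k ≟ n - i * i)))
        ≡⟨ ∑-cong interval (λ j → ∑-cong interval (term i j)) ⟩
      ∑ interval (λ j → ∑ interval (λ k → t i j k + t i k j))
        ≡⟨ ∑-cong interval (λ j → ∑-distrib-+ interval (t i j) (λ k → t i k j)) ⟩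
      ∑ interval (λ j → ∑ interval (t i j) + ∑ interval (λ k → t i k j))
        ≡⟨ ∑-distrib-+ interval (λ j → ∑ interval (t i j)) _ ⟩
      ∑ interval (λ j → ∑ interval (t i j)) + ∑ interval (λ j → ∑ interval (λ k → t i k j))
        ≡⟨ cong (_+_ (∑ interval (λ j → ∑ interval (t i j)))) (∑-swap interval interval (λ j k → t i k j)) ⟩
      ∑ interval (λ j → ∑ interval (t i j)) + ∑ interval (λ k → ∑ interval (t i k)) ∎
      where c = n - + 3 * (i * i)

  module _ {n : ℕ} (n≤M : n ℕ.≤ M) where

    private
      N = + n
      roots = ∑ positives (λ s → 𝟙 (s * s ≟ N))

    -- (δ − 2i)(d + i) = n − 3i² + i(δ − 2d) on the solutions of i² + dδ = n, and the last summand is odd in i.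
    ρ-recurrence : ∑ interval (λ i → (N - + 3 * (i * i)) * ρ (N - i * i)) ≡ N * roots
    ρ-recurrence = begin
      ∑ interval (λ i → (N - + 3 * (i * i)) * ρ (N - i * i))
        ≡⟨ trans (∑-cong interval expand) (sym (+-identityʳ _)) ⟩
      ∑ interval G + 0ℤ
        ≡⟨ cong (_+_ (∑ interval G)) (∑-interval-odd F F-odd) ⟨
      ∑ interval G + ∑ interval F
        ≡⟨ ∑-distrib-+ interval G F ⟨
      ∑ interval (λ i → G i + F i)
        ≡⟨ ∑-cong interval (λ i → trans (sym (∑-distrib-+ positives _ _))
             (∑-cong positives λ d → sym (∑-distrib-+ positives _ _))) ⟩
      ∑ interval (λ i → ∑ positives (λ d → ∑ positives (λ δ → g i d δ + f i d δ)))
        -- For members d and δ of `positives` the condition `Sol` amounts to the bare equation.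
        ≡⟨ ∑-cong interval (λ i → ∑-cong∈ positives (λ d∈ → ∑-cong∈ positives (λ δ∈ →
             collect i _ _ (∈-positives⇒>0 d∈) (∈-positives⇒>0 δ∈)))) ⟩
      ∑ interval (λ i → ∑ positives (λ d → ∑ positives (λ δ → h (i , d , δ))))
        ≡⟨ ∑-cong interval (λ i → ∑-cartesianProduct positives positives (λ y → h (i , y))) ⟨
      ∑ interval (λ i → ∑ (cartesianProduct positives positives) (λ y → h (i , y)))
        ≡⟨ ∑-cartesianProduct interval (cartesianProduct positives positives) h ⟨
      ∑ triples h
        ≡⟨ ∑-Sol n≤M ⟩
      N * roots ∎
      where
      open ≡-Reasoning
      eq? : ∀ i d δ → Dec (i * i + d * δ ≡ N)
      eq? i d δ = i * i + d * δ ≟ N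
      h : Triple → ℤ
      h x = 𝟙 (Sol? n≤M x) * weight x
      g f : ℤ → ℤ → ℤ → ℤ
      g i d δ = 𝟙 (eq? i d δ) * (χ δ * (N - + 3 * (i * i)))
      f i d δ = 𝟙 (eq? i d δ) * (χ δ * (i * (δ - + 2 * d)))
      G F : ℤ → ℤ
      G i = ∑ positives (λ d → ∑ positives (g i d))
      F i = ∑ positives (λ d → ∑ positives (f i d))
      F-odd : ∀ i → F (- i) ≡ - F i
      F-odd i = trans (∑-cong positives λ d → trans (∑-cong positives (f-odd d)) (∑-neg positives (f i d)))
                      (∑-neg positives (λ d → ∑ positives (f i d)))
        where
        even : ∀ i y → - i * - i + y ≡ i * i + y
        even = solve-∀
        pull : ∀ a b i c → a * (b * (- i * c)) ≡ - (a * (b * (i * c)))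
        pull = solve-∀
        f-odd : ∀ d δ → f (- i) d δ ≡ - f i d δ
        f-odd d δ = trans
          (cong (_* (χ δ * (- i * (δ - + 2 * d))))
            (𝟙-cong (eq? (- i) d δ) (eq? i d δ) (trans (sym (even i (d * δ)))) (trans (even i (d * δ)))))
          (pull (𝟙 (eq? i d δ)) (χ δ) i (δ - + 2 * d))
      collect : ∀ i d δ → 0ℤ < d → 0ℤ < δ → g i d δ + f i d δ ≡ h (i , d , δ)
      collect i d δ 0<d 0<δ = begin
        g i d δ + f i d δ
          ≡⟨ *-distribˡ-+ (𝟙 (eq? i d δ)) _ _ ⟨
        𝟙 (eq? i d δ) * (χ δ * (N - + 3 * (i * i)) + χ δ * (i * (δ - + 2 * d)))
          ≡⟨ 𝟙*-cong (eq? i d δ) (λ eq →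
               trans (cong (λ m → χ δ * (m - + 3 * (i * i)) + χ δ * (i * (δ - + 2 * d))) (sym eq)) (poly (χ δ) i d δ)) ⟩
        𝟙 (eq? i d δ) * weight (i , d , δ)
          ≡⟨ cong (_* weight (i , d , δ)) (𝟙-cong (eq? i d δ) (Sol? n≤M (i , d , δ)) (λ eq → eq , 0<d , 0<δ) proj₁) ⟩
        h (i , d , δ) ∎
        where
        poly : ∀ c i d δ → c * (i * i + d * δ - + 3 * (i * i)) + c * (i * (δ - + 2 * d))
                           ≡ c * ((δ - + 2 * i) * (d + i))
        poly = solve-∀
      expand : ∀ i → (N - + 3 * (i * i)) * ρ (N - i * i) ≡ G i
      expand i = trans (*-distribˡ-∑ c positives _) (∑-cong positives λ d →
        trans (*-distribˡ-∑ c positives _) (∑-cong positives (term d)))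
        where
        c = N - + 3 * (i * i)
        regroup : ∀ c a b → c * (a * b) ≡ a * (b * c)
        regroup = solve-∀
        term : ∀ d δ → c * (𝟙 (d * δ ≟ N - i * i) * χ δ) ≡ g i d δ
        term d δ = trans (regroup c (𝟙 (d * δ ≟ N - i * i)) (χ δ))
          (cong (_* (χ δ * c)) (𝟙-cong (d * δ ≟ N - i * i) (eq? i d δ) (y≡z-x⇒x+y≡z {i * i}) (x+y≡z⇒y≡z-x {i * i})))

    -- A term survives only if i² = n, where n - 3i² = -2n, and the roots s and -s together give
    -- -4n. The root i = 0 occurs only for n = 0, where the factor n removes it.
    δ₀-recurrence : ∑ interval (λ i → (N - + 3 * (i * i)) * 𝟙 (N - i * i ≟ 0ℤ)) ≡ - (+ 4 * (N * roots))
    δ₀-recurrence = begin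
      ∑ interval (λ i → (N - + 3 * (i * i)) * 𝟙 (N - i * i ≟ 0ℤ))
        ≡⟨ ∑-cong interval term ⟩
      ∑ interval (λ i → (- (+ 2 * N)) * 𝟙 (i * i ≟ N))
        ≡⟨ *-distribˡ-∑ (- (+ 2 * N)) interval _ ⟨
      (- (+ 2 * N)) * ∑ interval (λ i → 𝟙 (i * i ≟ N))
        ≡⟨ cong ((- (+ 2 * N)) *_) (∑-interval _) ⟩
      (- (+ 2 * N)) * (∑ positives (λ i → 𝟙 (- i * - i ≟ N)) + (𝟙 (0ℤ ≟ N) + roots))
        ≡⟨ cong (λ z → (- (+ 2 * N)) * (z + (𝟙 (0ℤ ≟ N) + roots)))
             (∑-cong positives λ i → 𝟙-cong (- i * - i ≟ N) (i * i ≟ N) (trans (sym (even i))) (trans (even i))) ⟩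
      (- (+ 2 * N)) * (roots + (𝟙 (0ℤ ≟ N) + roots))
        ≡⟨ poly N (𝟙 (0ℤ ≟ N)) roots ⟩
      - (+ 4 * (N * roots)) - + 2 * (𝟙 (0ℤ ≟ N) * N)
        ≡⟨ cong (λ z → - (+ 4 * (N * roots)) - + 2 * z)
             (trans (𝟙*-cong (0ℤ ≟ N) sym) (*-zeroʳ (𝟙 (0ℤ ≟ N)))) ⟩
      - (+ 4 * (N * roots)) - + 2 * 0ℤ
        ≡⟨ +-identityʳ _ ⟩
      - (+ 4 * (N * roots)) ∎
      where
      open ≡-Reasoning
      even : ∀ i → - i * - i ≡ i * i
      even = solve-∀
      poly : ∀ n z r → (- (+ 2 * n)) * (r + (z + r)) ≡ - (+ 4 * (n * r)) - + 2 * (z * n)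
      poly = solve-∀
      collapse : ∀ n → n - + 3 * n ≡ - (+ 2 * n)
      collapse = solve-∀
      term : ∀ i → (N - + 3 * (i * i)) * 𝟙 (N - i * i ≟ 0ℤ) ≡ (- (+ 2 * N)) * 𝟙 (i * i ≟ N)
      term i = begin
        (N - + 3 * (i * i)) * 𝟙 (N - i * i ≟ 0ℤ)
          ≡⟨ *-comm (N - + 3 * (i * i)) _ ⟩
        𝟙 (N - i * i ≟ 0ℤ) * (N - + 3 * (i * i))
          ≡⟨ cong (_* (N - + 3 * (i * i))) (𝟙-cong (N - i * i ≟ 0ℤ) (i * i ≟ N)
               (λ eq → sym (i-j≡0⇒i≡j N (i * i) eq)) (λ eq → i≡j⇒i-j≡0 (sym eq))) ⟩
        𝟙 (i * i ≟ N) * (N - + 3 * (i * i))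
          ≡⟨ 𝟙*-cong (i * i ≟ N) (λ eq → trans (cong (λ z → N - + 3 * z) eq) (collapse N)) ⟩
        𝟙 (i * i ≟ N) * - (+ 2 * N)
          ≡⟨ *-comm (𝟙 (i * i ≟ N)) _ ⟩
        (- (+ 2 * N)) * 𝟙 (i * i ≟ N) ∎

  -- The indicator supplies the value r₂(0) = 1, as ρ(0) = 0: no product of positive integers is 0.
  defect : ℤ → ℤ
  defect m = r₂ m - + 4 * ρ m - 𝟙 (m ≟ 0ℤ)

  -- Let X be n times the number of positive square roots of n. The recurrences for `r₂`, `ρ` and
  -- the indicator have the values 0, X and -4X, and 0 - 4X + 4X = 0.
  defect-recurrence : ∀ {n} → n ℕ.≤ M → ∑ interval (λ i → (+ n - + 3 * (i * i)) * defect (+ n - i * i)) ≡ 0ℤ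
  defect-recurrence {n} n≤M = begin
    ∑ interval (λ i → c i * defect (+ n - i * i))
      ≡⟨ ∑-cong interval (λ i → poly (c i) (r₂ (+ n - i * i)) (ρ (+ n - i * i)) (𝟙 (+ n - i * i ≟ 0ℤ))) ⟩
    ∑ interval (λ i → R i + ((- + 4) * T i + - Z i))
      ≡⟨ ∑-distrib-+ interval R (λ i → (- + 4) * T i + - Z i) ⟩
    ∑ interval R + ∑ interval (λ i → (- + 4) * T i + - Z i)
      ≡⟨ cong (_+_ (∑ interval R)) (∑-distrib-+ interval (λ i → (- + 4) * T i) (λ i → - Z i)) ⟩
    ∑ interval R + (∑ interval (λ i → (- + 4) * T i) + ∑ interval (λ i → - Z i))
      ≡⟨ cong₂ _+_ (r₂-recurrence (+ n)) (cong₂ _+_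
           (trans (sym (*-distribˡ-∑ (- + 4) interval T)) (cong ((- + 4) *_) (ρ-recurrence n≤M)))
           (trans (∑-neg interval Z) (cong -_ (δ₀-recurrence n≤M)))) ⟩
    0ℤ + ((- + 4) * s + - - (+ 4 * s))
      ≡⟨ cancel s ⟩
    0ℤ ∎
    where
    open ≡-Reasoning
    c R T Z : ℤ → ℤ
    c i = + n - + 3 * (i * i)
    R i = c i * r₂ (+ n - i * i)
    T i = c i * ρ (+ n - i * i)
    Z i = c i * 𝟙 (+ n - i * i ≟ 0ℤ)
    s = + n * ∑ positives (λ s → 𝟙 (s * s ≟ + n))
    poly : ∀ c x y z → c * (x - + 4 * y - z) ≡ c * x + ((- + 4) * (c * y) + - (c * z))
    poly = solve-∀
    cancel : ∀ s → 0ℤ + ((- + 4) * s + - - (+ 4 * s)) ≡ 0ℤ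
    cancel = solve-∀

  r₂-neg : ∀ k → r₂ -[1+ k ] ≡ 0ℤ
  r₂-neg k = trans (∑-cong interval λ a → trans (∑-cong interval λ b → 𝟙-no (a * a + b * b ≟ -[1+ k ]) (impossible a b))
                                                (∑-zero interval)) (∑-zero interval)
    where
    impossible : ∀ a b → a * a + b * b ≢ -[1+ k ]
    impossible a b eq with () ← trans (sym (cong₂ _+_ (square a) (square b))) eq

  ρ-nonpos : ∀ {m} → m ≤ 0ℤ → ρ m ≡ 0ℤ
  ρ-nonpos {m} m≤0 = trans (∑-cong∈ positives λ d∈ → trans (∑-cong∈ positives λ δ∈ → vanish d∈ δ∈)
                                                           (∑-zero positives)) (∑-zero positives)
    where
    vanish : ∀ {d δ} → d ∈ positives → δ ∈ positives → 𝟙 (d * δ ≟ m) * χ δ ≡ 0ℤ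
    vanish {d} {δ} d∈ δ∈ with _ , _ , refl ← ∈-positives⁻ d∈ | _ , _ , refl ← ∈-positives⁻ δ∈ =
      trans (cong (_* χ δ) (𝟙-no (d * δ ≟ m) λ eq → <-irrefl refl (<-≤-trans (subst (0ℤ <_) eq (+<+ ℕ.z<s)) m≤0)))
            (*-zeroˡ (χ δ))

  r₂-0 : r₂ 0ℤ ≡ 1ℤ
  r₂-0 = trans (∑-interval-at-0 _ λ a a≢0 → trans (∑-cong interval λ b → off a b a≢0) (∑-zero interval))
               (∑-interval-at-0 _ λ b b≢0 → off′ b b≢0)
    where
    off : ∀ a b → a ≢ 0ℤ → 𝟙 (a * a + b * b ≟ 0ℤ) ≡ 0ℤ
    off a b a≢0 = 𝟙-no (a * a + b * b ≟ 0ℤ) λ eq → case i²≥1 a a≢0 of λ (_ , a²) →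
      case trans (sym (cong₂ _+_ a² (square b))) eq of λ ()
    off′ : ∀ b → b ≢ 0ℤ → 𝟙 (0ℤ * 0ℤ + b * b ≟ 0ℤ) ≡ 0ℤ
    off′ b b≢0 = 𝟙-no (0ℤ * 0ℤ + b * b ≟ 0ℤ) λ eq → case i²≥1 b b≢0 of λ (_ , b²) →
      case trans (sym (cong (_+_ (0ℤ * 0ℤ)) b²)) eq of λ ()

  defect-neg : ∀ k → defect -[1+ k ] ≡ 0ℤ
  defect-neg k = cong₂ (λ x y → x - + 4 * y - 0ℤ) (r₂-neg k) (ρ-nonpos { -[1+ k ]} -≤+)

  -- For i ≠ 0 the recurrence involves the defect at n - i² < n, which vanishes by induction or
  -- because the argument is negative. The term i = 0 is n times the defect at n, and n can be
  -- cancelled unless it is 0.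
  defect≡0 : ∀ n → n ℕ.≤ M → defect (+ n) ≡ 0ℤ
  defect≡0 = <-rec (λ n → n ℕ.≤ M → defect (+ n) ≡ 0ℤ) step
    where
    step : ∀ n → (∀ {k} → k ℕ.< n → k ℕ.≤ M → defect (+ k) ≡ 0ℤ) → n ℕ.≤ M → defect (+ n) ≡ 0ℤ
    step zero    _   _   = cong₂ (λ x y → x - + 4 * y - 1ℤ) r₂-0 (ρ-nonpos ≤-refl)
    step n@(suc _) rec n≤M = [ (λ ()) , id ]′ (i*j≡0⇒i≡0∨j≡0 (+ n) n*defect≡0)
      where
      earlier : ∀ m q → +[1+ q ] + m ≡ + n → defect m ≡ 0ℤ
      earlier -[1+ k ] q eq = defect-neg k
      earlier (+ k)    q eq = rec k<n (ℕ.≤-trans (ℕ.<⇒≤ k<n) n≤M)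
        where
        k<n : k ℕ.< n
        k<n = subst (k ℕ.<_) (+-injective eq) (ℕ.m<n+m k {suc q} ℕ.z<s)
      off-0 : ∀ i → i ≢ 0ℤ → (+ n - + 3 * (i * i)) * defect (+ n - i * i) ≡ 0ℤ
      off-0 i i≢0 with q , i² ← i²≥1 i i≢0 = trans
        (cong ((+ n - + 3 * (i * i)) *_)
          (earlier (+ n - i * i) q (trans (cong (_+ (+ n - i * i)) (sym i²)) (y≡z-x⇒x+y≡z {i * i} refl))))
        (*-zeroʳ (+ n - + 3 * (i * i)))
      n*defect≡0 : + n * defect (+ n) ≡ 0ℤ
      n*defect≡0 = begin
        + n * defect (+ n)
          ≡⟨ cong₂ (λ x y → x * defect y) (+-identityʳ (+ n)) (+-identityʳ (+ n)) ⟨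
        (+ n - + 3 * (0ℤ * 0ℤ)) * defect (+ n - 0ℤ * 0ℤ)
          ≡⟨ ∑-interval-at-0 _ off-0 ⟨
        ∑ interval (λ i → (+ n - + 3 * (i * i)) * defect (+ n - i * i))
          ≡⟨ defect-recurrence n≤M ⟩
        0ℤ ∎
        where open ≡-Reasoning

  jacobi : ∀ {n} → n ℕ.≤ M → r₂ (+ n) ≡ 𝟙 (+ n ≟ 0ℤ) + + 4 * ρ (+ n)
  jacobi {n} n≤M = begin
    r₂ (+ n)                             ≡⟨ regroup (r₂ (+ n)) (ρ (+ n)) (𝟙 (+ n ≟ 0ℤ)) ⟩
    defect (+ n) + target                ≡⟨ cong (_+ target) (defect≡0 n n≤M) ⟩
    0ℤ + target                          ≡⟨ +-identityˡ target ⟩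
    target                               ∎
    where
    open ≡-Reasoning
    target = 𝟙 (+ n ≟ 0ℤ) + + 4 * ρ (+ n)
    regroup : ∀ x y z → x ≡ x - + 4 * y - z + (z + + 4 * y)
    regroup = solve-∀

  -- Counting lattice points

  ∑-r₂ : ∑ interval (λ a → ∑ interval (λ b → 𝟙 (a * a + b * b ≤? + M))) ≡ ∑ (upTo (suc M)) (λ m → r₂ (+ m))
  ∑-r₂ = begin
    ∑ interval (λ a → ∑ interval (λ b → 𝟙 (a * a + b * b ≤? + M)))
      ≡⟨ ∑-cong interval (λ a → ∑-cong interval (λ b → ∑-𝟙≡ M (0≤a²+b² a b))) ⟨
    ∑ interval (λ a → ∑ interval (λ b → ∑ (upTo (suc M)) (λ m → 𝟙 (a * a + b * b ≟ + m))))
      ≡⟨ ∑-cong interval (λ a → ∑-swap interval (upTo (suc M)) (λ b m → 𝟙 (a * a + b * b ≟ + m))) ⟩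
    ∑ interval (λ a → ∑ (upTo (suc M)) (λ m → ∑ interval (λ b → 𝟙 (a * a + b * b ≟ + m))))
      ≡⟨ ∑-swap interval (upTo (suc M)) (λ a m → ∑ interval (λ b → 𝟙 (a * a + b * b ≟ + m))) ⟩
    ∑ (upTo (suc M)) (λ m → r₂ (+ m)) ∎
    where
    open ≡-Reasoning
    0≤a²+b² : ∀ a b → 0ℤ ≤ a * a + b * b
    0≤a²+b² a b = subst (0ℤ ≤_) (sym (cong₂ _+_ (square a) (square b))) (+≤+ z≤n)

  -- The pairs with dδ ≤ M are sorted by d = j + 1; for fixed d, the cofactor δ = k + 1 runs up to
  -- ⌊M/d⌋.
  ∑-ρ : ∑ (upTo (suc M)) (λ m → ρ (+ m)) ≡ ∑< M (λ j → ∑< (M ℕ./ suc j) (χℕ ∘ suc))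
  ∑-ρ = begin
    ∑ U (λ m → ρ (+ m))
      ≡⟨ ∑-swap positives U (λ d m → ∑ positives (λ δ → 𝟙 (d * δ ≟ + m) * χ δ)) ⟨
    ∑ positives (λ d → ∑ U (λ m → ∑ positives (λ δ → 𝟙 (d * δ ≟ + m) * χ δ)))
      ≡⟨ ∑-cong positives (λ d → ∑-swap positives U (λ δ m → 𝟙 (d * δ ≟ + m) * χ δ)) ⟨
    ∑ positives (λ d → ∑ positives (λ δ → ∑ U (λ m → 𝟙 (d * δ ≟ + m) * χ δ)))
      ≡⟨ ∑-positives _ ⟩
    ∑< M (λ j → ∑ positives (λ δ → ∑ U (λ m → 𝟙 (+[1+ j ] * δ ≟ + m) * χ δ)))
      ≡⟨ ∑<-cong M (λ j → trans (∑-positives _) (trans (∑<-cong M (cell j))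
           (∑<-truncate (m/n≤m M (suc j)) (χℕ ∘ suc)))) ⟩
    ∑< M (λ j → ∑< (M ℕ./ suc j) (χℕ ∘ suc)) ∎
    where
    open ≡-Reasoning
    U = upTo (suc M)
    k<M/j : ∀ j k → suc j ℕ.* suc k ℕ.≤ M → k ℕ.< M ℕ./ suc j
    k<M/j j k le = ℕ.≤-trans (ℕ.≤-reflexive (sym (m*n/n≡m (suc k) (suc j))))
      (/-monoˡ-≤ (suc j) (ℕ.≤-trans (ℕ.≤-reflexive (ℕ.*-comm (suc k) (suc j))) le))
    jk≤M : ∀ j k → k ℕ.< M ℕ./ suc j → suc j ℕ.* suc k ℕ.≤ M
    jk≤M j k lt = ℕ.≤-trans (ℕ.≤-reflexive (ℕ.*-comm (suc j) (suc k)))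
      (ℕ.≤-trans (ℕ.*-monoˡ-≤ (suc j) lt) (m/n*n≤m M (suc j)))
    cell : ∀ j k → ∑ U (λ m → 𝟙 (+[1+ j ] * +[1+ k ] ≟ + m) * χℕ (suc k)) ≡
                   𝟙 (k ℕ.<? M ℕ./ suc j) * χℕ (suc k)
    cell j k = begin
      ∑ U (λ m → 𝟙 (+[1+ j ] * +[1+ k ] ≟ + m) * c)
        ≡⟨ ∑-cong U (λ m → *-comm (𝟙 (+[1+ j ] * +[1+ k ] ≟ + m)) c) ⟩
      ∑ U (λ m → c * 𝟙 (+[1+ j ] * +[1+ k ] ≟ + m))
        ≡⟨ *-distribˡ-∑ c U (λ m → 𝟙 (+[1+ j ] * +[1+ k ] ≟ + m)) ⟨
      c * ∑ U (λ m → 𝟙 (+[1+ j ] * +[1+ k ] ≟ + m))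
        ≡⟨ cong (c *_) (∑-𝟙≡ M (+≤+ z≤n)) ⟩
      c * 𝟙 (+[1+ j ] * +[1+ k ] ≤? + M)
        ≡⟨ cong (c *_) (𝟙-cong (+[1+ j ] * +[1+ k ] ≤? + M) (k ℕ.<? M ℕ./ suc j)
             (k<M/j j k ∘ drop‿+≤+) (+≤+ ∘ jk≤M j k)) ⟩
      c * 𝟙 (k ℕ.<? M ℕ./ suc j)
        ≡⟨ *-comm c (𝟙 (k ℕ.<? M ℕ./ suc j)) ⟩
      𝟙 (k ℕ.<? M ℕ./ suc j) * c ∎
      where c = χℕ (suc k)

  points : List (ℤ × ℤ)
  points = cartesianProduct interval interval

  points! : Unique points
  points! = Unique.cartesianProduct⁺ interval! interval!

  -- Written with `^ 2` to agree with the theorem, whereas the sums use products, which suit the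
  -- ring solver.
  InDisc : ℤ × ℤ → Set
  InDisc (a , b) = a ^ 2 + b ^ 2 ≤ + M

  InDisc? : Decidable InDisc
  InDisc? (a , b) = a ^ 2 + b ^ 2 ≤? + M

  z^2≡z*z : ∀ z → z ^ 2 ≡ z * z
  z^2≡z*z z = cong (z *_) (*-identityʳ z)

  InDisc⇒∈ : ∀ {x} → InDisc x → x ∈ points
  InDisc⇒∈ {a , b} le = ∈-cartesianProduct⁺
    (∈-interval⁺ (ℕ.≤-trans (k≤k*k ∣ a ∣) (ℕ.≤-trans (ℕ.m≤m+n (∣ a ∣ ℕ.* ∣ a ∣) (∣ b ∣ ℕ.* ∣ b ∣)) leℕ)))
    (∈-interval⁺ (ℕ.≤-trans (k≤k*k ∣ b ∣) (ℕ.≤-trans (ℕ.m≤n+m (∣ b ∣ ℕ.* ∣ b ∣) (∣ a ∣ ℕ.* ∣ a ∣)) leℕ)))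
    where
    leℕ : ∣ a ∣ ℕ.* ∣ a ∣ ℕ.+ ∣ b ∣ ℕ.* ∣ b ∣ ℕ.≤ M
    leℕ = drop‿+≤+ (subst (_≤ + M) (cong₂ _+_ (trans (z^2≡z*z a) (square a)) (trans (z^2≡z*z b) (square b))) le)

  count : + length (filter InDisc? points) ≡ 1ℤ + + 4 * ∑< M (λ j → ∑< (M ℕ./ suc j) (χℕ ∘ suc))
  count = begin
    + length (filter InDisc? points)
      ≡⟨ length-filter InDisc? points ⟩
    ∑ points (λ x → 𝟙 (InDisc? x))
      ≡⟨ ∑-cartesianProduct interval interval (λ x → 𝟙 (InDisc? x)) ⟩
    ∑ interval (λ a → ∑ interval (λ b → 𝟙 (a ^ 2 + b ^ 2 ≤? + M)))
      ≡⟨ ∑-cong interval (λ a → ∑-cong interval (λ b →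
           cong (λ z → 𝟙 (z ≤? + M)) (cong₂ _+_ (z^2≡z*z a) (z^2≡z*z b)))) ⟩
    ∑ interval (λ a → ∑ interval (λ b → 𝟙 (a * a + b * b ≤? + M)))
      ≡⟨ ∑-r₂ ⟩
    ∑ U (λ m → r₂ (+ m))
      ≡⟨ ∑-cong∈ U (λ m∈ → jacobi (ℕ.s≤s⁻¹ (∈-upTo⁻ m∈))) ⟩
    ∑ U (λ m → 𝟙 (+ m ≟ 0ℤ) + + 4 * ρ (+ m))
      ≡⟨ ∑-distrib-+ U (λ m → 𝟙 (+ m ≟ 0ℤ)) (λ m → + 4 * ρ (+ m)) ⟩
    ∑ U (λ m → 𝟙 (+ m ≟ 0ℤ)) + ∑ U (λ m → + 4 * ρ (+ m))
      ≡⟨ cong₂ _+_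
           -- Summed over all m, the indicator of m = 0 contributes 1: the origin of the plane.
           (trans (∑-cong U (λ m → 𝟙-cong (+ m ≟ 0ℤ) (0ℤ ≟ + m) sym sym))
             (trans (∑-𝟙≡ {0ℤ} M ≤-refl) (𝟙-yes (0ℤ ≤? + M) (+≤+ z≤n))))
           (sym (*-distribˡ-∑ (+ 4) U (λ m → ρ (+ m)))) ⟩
    1ℤ + + 4 * ∑ U (λ m → ρ (+ m))
      ≡⟨ cong (λ s → 1ℤ + + 4 * s) ∑-ρ ⟩
    1ℤ + + 4 * ∑< M (λ j → ∑< (M ℕ./ suc j) (χℕ ∘ suc)) ∎
    where
    open ≡-Reasoning
    U = upTo (suc M)

proposition3p5 : (n : ℕ) .{{_ : NonZero n}} →
    HasCardinality
    (Σ[ (a , b) ∈ ℤ × ℤ ] a ^ 2 + b ^ 2 ≤ + (2 ℕ.* n))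
    (4 ℕ.* 𝓡 n ℕ.+ 4 ℕ.* n ℕ.+ 1)
proposition3p5 n = subst (HasCardinality _) length≡ (filter-HasCardinality InDisc? ≤-irrelevant points! InDisc⇒∈)
  where
  open Box (2 ℕ.* n)
  open ≡-Reasoning
  distribute : ∀ r n → 1ℤ + + 4 * (r + n) ≡ + 4 * r + + 4 * n + 1ℤ
  distribute = solve-∀
  length≡ : length (filter InDisc? points) ≡ 4 ℕ.* 𝓡 n ℕ.+ 4 ℕ.* n ℕ.+ 1
  length≡ = +-injective (begin
    + length (filter InDisc? points)       ≡⟨ count ⟩
    1ℤ + + 4 * ∑< (2 ℕ.* n) (λ j → ∑< (2 ℕ.* n ℕ./ suc j) (χℕ ∘ suc))
                                           ≡⟨ cong (λ s → 1ℤ + + 4 * s) (∑-quotients n) ⟩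
    1ℤ + + 4 * (+ 𝓡 n + + n)               ≡⟨ distribute (+ 𝓡 n) (+ n) ⟩
    + 4 * + 𝓡 n + + 4 * + n + 1ℤ           ≡⟨ cong₂ (λ x y → x + y + 1ℤ) (pos-* 4 (𝓡 n)) (pos-* 4 n) ⟨
    + (4 ℕ.* 𝓡 n ℕ.+ 4 ℕ.* n ℕ.+ 1)        ∎)
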